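{- There exists a randomized online algorithm for the online load balancing problem on unrelated machines, with the objective of minimizing the sum of the squared loads, that is $4.9843$-competitive: for every instance, the random assignment $X$ it produces satisfies $$\mathbb{E}\Big[\sum_{i\in M} L_i(X)^2\Big]\;\le\; 4.9843\cdot \mathrm{OPT},$$ where $\mathrm{OPT}$ is the minimum of $\sum_{i\in M} L_i(x)^2$ over all integral assignments $x$ of the instance.
   Context: Online load balancing problem on unrelated machines: a finite set of machines $M$ is given. Jobs $J=\{1,\dots,n\}$ arrive one by one in this (adversarial) order; $n$ is not known in advance. When job $j$ arrives, it reveals a nonempty set $\mathcal S_j\subseteq M$ of feasible machines and weights $w_{ij}\ge 0$ for $i\in\mathcal S_j$. An integral assignment is a vector $x_{ij}\in\{0,1\}$ with $\sum_{i\in\mathcal S_j}x_{ij}=1$ for every $j$ and $x_{ij}=0$ for $i\notin \mathcal S_j$. The load of machine $i$ is $L_i(x)=\sum_{j\in J}w_{ij}x_{ij}$ and the cost is $\sum_{i\in M}L_i(x)^2$. A randomized online algorithm must, at the arrival of job $j$, irrevocably assign it to a (possibly random) machine in $\mathcal S_j$, using only $M$, the data $(\mathcal S_k, (w_{ik})_{i\in \mathcal{S}_k})_{k\le j}$ revealed so far, its earlier decisions and its own randomness; $X_{ij}\in\{0,1\}$ is the indicator that $j$ is assigned to $i$. The instance is fixed independently of the algorithm's randomness. -}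

module Defs where

open import Algebra.Bundles using (CommutativeRing)
open import Data.Fin using (Fin; _≟_)
open import Data.Fin.Subset using (Subset; _∈_; Nonempty)
open import Data.List using (List; []; _∷_)
open import Data.List.Relation.Unary.All using (All; []; _∷_)
open import Data.Nat using (ℕ)
open import Data.Product using (∃; _×_; _,_; proj₁)
open import Level using (0ℓ)
open import Relation.Binary.Structures using (IsDecTotalOrder)
open import Relation.Nullary using (¬_; yes; no)

import Algebra.Definitions.RawMonoid as RawMonoidDefinitions

-- The real numbers, given axiomatically as a Dedekind-complete ordered field.
-- Decidability of the order and suprema of arbitrary bounded inhabited
-- predicates give the classical (not the constructive) reals, unique up to
-- isomorphism.
record Reals : Set₁ where
  infix 4 _≤_
  infix 8 _⁻¹
  infixl 7 _/_
  field
    commutativeRing : CommutativeRing 0ℓ 0ℓ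
  open CommutativeRing commutativeRing public
  field
    _≤_             : Carrier → Carrier → Set
    isDecTotalOrder : IsDecTotalOrder _≈_ _≤_
    +-monoˡ-≤       : ∀ {x y} z → x ≤ y → x + z ≤ y + z
    *-nonneg        : ∀ {x y} → 0# ≤ x → 0# ≤ y → 0# ≤ x * y
    0≉1             : ¬ 0# ≈ 1#
    -- The value of 0# ⁻¹ is unspecified.
    _⁻¹             : Carrier → Carrier
    *-inverseʳ      : ∀ {x} → ¬ x ≈ 0# → x * x ⁻¹ ≈ 1#

  IsUpperBound : (Carrier → Set) → Carrier → Set
  IsUpperBound P u = ∀ {x} → P x → x ≤ u

  field
    supremum : (P : Carrier → Set) → ∃ P → ∃ (IsUpperBound P) →
               ∃ λ s → IsUpperBound P s × (∀ {u} → IsUpperBound P u → s ≤ u)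

  private module Σ⁺ = RawMonoidDefinitions +-rawMonoid

  sum : ∀ {n} → (Fin n → Carrier) → Carrier
  sum = Σ⁺.sum

  fromℕ : ℕ → Carrier
  fromℕ n = n Σ⁺.× 1#

  _/_ : Carrier → Carrier → Carrier
  x / y = x * y ⁻¹

  IsMinimum : {A : Set} → (A → Carrier) → Carrier → Set
  IsMinimum f v = (∃ λ x → f x ≈ v) × (∀ x → v ≤ f x)

module LoadBalancing (ℝ : Reals) where
  open Reals ℝ

  -- The machines are M = Fin m; weights exist only for feasible machines.
  record Job (m : ℕ) : Set where
    field
      feasible    : Subset m
      nonempty    : Nonempty feasible
      weight      : ∃ (_∈ feasible) → Carrier
      weight≥0    : ∀ i → 0# ≤ weight i

  FeasibleMachine : ∀ {m} → Job m → Set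
  FeasibleMachine j = ∃ (_∈ Job.feasible j)

  -- In order of arrival.
  Instance : ℕ → Set
  Instance m = List (Job m)

  -- The 0/1 vector x is represented by the unique feasible machine i with
  -- x i j = 1, for each job j.
  Assignment : ∀ {m} → Instance m → Set
  Assignment jobs = All FeasibleMachine jobs

  contribution : ∀ {m} (j : Job m) → FeasibleMachine j → Fin m → Carrier
  contribution j s i with proj₁ s ≟ i
  ... | yes _ = Job.weight j s
  ... | no  _ = 0#

  load : ∀ {m} {jobs : Instance m} → Assignment jobs → Fin m → Carrier
  load {jobs = []}    []      i = 0#
  load {jobs = j ∷ _} (s ∷ x) i = contribution j s i + load x i

  cost : ∀ {m} {jobs : Instance m} → Assignment jobs → Carrier
  cost x = sum (λ i → load x i * load x i)

  -- Finitely supported probability distributions with real probabilities.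
  record Distribution (A : Set) : Set where
    field
      size    : ℕ
      outcome : Fin size → A
      prob    : Fin size → Carrier
      prob≥0  : ∀ k → 0# ≤ prob k
      sum≈1   : sum prob ≈ 1#

  𝔼 : {A : Set} → Distribution A → (A → Carrier) → Carrier
  𝔼 D f = sum (λ k → prob k * f (outcome k))
    where open Distribution D

  -- The memory can hold everything the algorithm has seen so far: the revealed
  -- data, its own decisions and the outcomes of its coin flips.  A step sees
  -- the memory and the arriving job only; neither later jobs nor their number
  -- are available to it.  Finitely supported steps are no restriction: for any
  -- source of randomness, the law of the decisions on a fixed instance is
  -- determined by the conditional laws of each decision given the revealed data
  -- and the earlier decisions, and these live on the finite set of feasible
  -- machines.
  record RandomizedOnlineAlgorithm (m : ℕ) : Set₁ where
    field
      Memory  : Set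
      initial : Distribution Memory
      step    : Memory → (j : Job m) → Distribution (Memory × FeasibleMachine j)

  module _ {m : ℕ} (A : RandomizedOnlineAlgorithm m) where
    open RandomizedOnlineAlgorithm A

    -- The expectation of f X, where X is the random assignment produced from a
    -- given memory, as an iterated expectation over the successive steps.
    expectationFrom : Memory → (jobs : Instance m) →
                      (Assignment jobs → Carrier) → Carrier
    expectationFrom μ []         f = f []
    expectationFrom μ (j ∷ jobs) f =
      𝔼 (step μ j) λ (μ′ , s) → expectationFrom μ′ jobs λ x → f (s ∷ x)

    expectation : (jobs : Instance m) → (Assignment jobs → Carrier) → Carrier
    expectation jobs f = 𝔼 initial λ μ → expectationFrom μ jobs f

{-# OPTIONS --safe #-}

-- A fractional assignment is built greedily: each job is cut into 64 chunks,
-- and every chunk goes to a feasible machine of least marginal price, which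
-- gives the fractional loads L.  The job itself then follows one of two
-- independent uniformly random chunks a and b.  If each choice were fair and
-- independent, one would get a ratio of about 5; the improvement comes from
-- negative correlation.  A machine is engaged by a job of weight w if 3 L ≤ 8 w.  If the
-- machine of a is engaged, then with probability 1/2 a fresh coin chooses
-- between a and b and is remembered in the token of that machine, and with
-- probability 1/2 the remembered coin is used in the opposite direction and
-- forgotten.  Only first and second moments of the random loads R and tokens S
-- matter: E S = 0, E R = L, distinct tokens are uncorrelated, the load of one
-- machine is never positively correlated with the token of another, and
-- E[R i * S i] ≥ K i for a deterministic K with 0 ≤ 16 K ≤ L.  This lowers the
-- increase of E R² on an engaged machine by at least w x (1 - x) K / 2.
--
-- The potential Σ (E R² + L² - L K / 4) grows by at most the total price paid
-- for the chunks, hence by at most the final price on the machine chosen by the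
-- optimum.  With optimal loads T this gives
--   E[cost] ≤ Σ (T * rate T L - 63/64 L²) ≤ 159/32 Σ T²,
-- and 159/32 = 4.96875.

module Submission where

open import Defs
open import Algebra.Bundles using (RawRing)
open import Algebra.Solver.Ring.AlmostCommutativeRing
  using (fromCommutativeRing; _-Raw-AlmostCommutative⟶_)
open import Data.Bool using (Bool; true; false; if_then_else_)
open import Data.Fin using (Fin; zero; suc; _↑ˡ_; _↑ʳ_; combine; remQuot; _≟_)
open import Data.Fin.Patterns using (0F; 1F; 2F; 3F)
open import Data.Fin.Properties using (remQuot-combine)
open import Data.Fin.Subset using (Subset; _∈_; Nonempty; inside; outside)
open import Data.Fin.Subset.Properties using (_∈?_)
open import Data.Integer as ℤ using (ℤ; +_; -[1+_]; _⊖_; _◃_)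
open import Data.List using ([]; _∷_)
open import Data.List.Relation.Unary.All using ([]; _∷_)
open import Data.Maybe using (Maybe; just; nothing)
open import Data.Nat as ℕ using (ℕ; zero; suc)
open import Data.Product using (_,_; Σ; ∃; _×_; proj₁; proj₂)
open import Data.Rational.Unnormalised using (ℚᵘ; mkℚᵘ; 0ℚᵘ; 1ℚᵘ; ↥_; ↧_; ↧ₙ_)
open import Data.Sum using (_⊎_; inj₁; inj₂)
open import Data.Vec using ([]; _∷_; here; there)
open import Data.Vec.Functional using (updateAt)
open import Data.Vec.Functional.Properties using (updateAt-updates; updateAt-minimal)
open import Data.Vec.Properties.WithK using ([]=-irrelevant)
open import Function using (_∘_; const)
open import Relation.Binary.Bundles using (TotalOrder)
open import Relation.Binary.PropositionalEquality as ≡ using (_≡_; _≢_)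
open import Relation.Binary.Structures using (IsDecTotalOrder)
open import Relation.Nullary using (¬_; yes; no; contradiction; does; Dec)
import Algebra.Properties.Ring as RingProperties
import Algebra.Properties.Semiring.Mult as SemiringMult
import Algebra.Properties.Semiring.Sum as SemiringSum
import Algebra.Solver.Ring as RingSolver
import Algebra.Solver.Ring.NaturalCoefficients.Default as SemiringSolver
import Data.Integer.Properties as ℤ
import Data.Nat.Properties as ℕ
import Data.Rational as ℚ
import Data.Rational.Properties as ℚ
import Data.Rational.Unnormalised as Unnormalised
import Data.Sign as Sign
open Sign using (Sign)
import Relation.Binary.Properties.TotalOrder as TotalOrderProperties
import Relation.Binary.Reasoning.Setoid as SetoidReasoning

-- Ordered-field arithmetic.

module Field (ℝ : Reals) where
  open Reals ℝ renaming (zero to *-zero; _/_ to _÷_)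
  open IsDecTotalOrder isDecTotalOrder public
    using (_≤?_; total; antisym)
    renaming (refl to ≤-refl; trans to ≤-trans; reflexive to ≤-reflexive)
  open RingProperties ring public
    using (-‿distribˡ-*; -‿distribʳ-*; -‿involutive; -0#≈0#; -‿+-comm)
  open SemiringMult semiring using (×1-homo-*; ×-homo-+; ×-congˡ)

  totalOrder : TotalOrder _ _ _
  totalOrder = record { isTotalOrder = IsDecTotalOrder.isTotalOrder isDecTotalOrder }

  open TotalOrderProperties totalOrder public using (≰⇒≥)

  private
    module ≈ = SetoidReasoning setoid
    module S = SemiringSolver commutativeSemiring

  ≤-respˡ : ∀ {x y z} → x ≈ y → x ≤ z → y ≤ z
  ≤-respˡ x≈y = ≤-trans (≤-reflexive (sym x≈y))

  ≤-respʳ : ∀ {x y z} → y ≈ z → x ≤ y → x ≤ z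
  ≤-respʳ y≈z x≤y = ≤-trans x≤y (≤-reflexive y≈z)

  +-mono-≤ : ∀ {x y u v} → x ≤ y → u ≤ v → x + u ≤ y + v
  +-mono-≤ {x} {y} {u} {v} x≤y u≤v = ≤-trans (+-monoˡ-≤ u x≤y)
    (≤-respˡ (+-comm u y) (≤-respʳ (+-comm v y) (+-monoˡ-≤ y u≤v)))

  +-nonneg : ∀ {x y} → 0# ≤ x → 0# ≤ y → 0# ≤ x + y
  +-nonneg 0≤x 0≤y = ≤-respˡ (+-identityˡ 0#) (+-mono-≤ 0≤x 0≤y)

  -- Inequalities below are proved by exhibiting the nonnegative difference.
  ≤-by : ∀ {x y p} → 0# ≤ p → y ≈ x + p → x ≤ y
  ≤-by {x} 0≤p y≈x+p =
    ≤-respˡ (+-identityʳ x) (≤-respʳ (sym y≈x+p) (+-mono-≤ ≤-refl 0≤p))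

  ≤⇒0≤- : ∀ {x y} → x ≤ y → 0# ≤ y - x
  ≤⇒0≤- {x} x≤y = ≤-respˡ (-‿inverseʳ x) (+-monoˡ-≤ (- x) x≤y)

  0≤-⇒≤ : ∀ {x y} → 0# ≤ y - x → x ≤ y
  0≤-⇒≤ {x} {y} 0≤y-x = ≤-by 0≤y-x (begin
    y             ≈⟨ +-identityˡ y ⟨
    0# + y        ≈⟨ +-congʳ (-‿inverseʳ x) ⟨
    x - x + y     ≈⟨ +-assoc x (- x) y ⟩
    x + (- x + y) ≈⟨ +-congˡ (+-comm (- x) y) ⟩
    x + (y - x)   ∎)
    where open ≈

  0≤- : ∀ {x} → x ≤ 0# → 0# ≤ - x
  0≤- {x} x≤0 = ≤-respʳ (+-identityˡ (- x)) (≤⇒0≤- x≤0)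

  square≥0 : ∀ x → 0# ≤ x * x
  square≥0 x with total 0# x
  ... | inj₁ 0≤x = *-nonneg 0≤x 0≤x
  ... | inj₂ x≤0 = ≤-respʳ (begin
    - x * - x     ≈⟨ -‿distribˡ-* x (- x) ⟨
    - (x * - x)   ≈⟨ -‿cong (-‿distribʳ-* x x) ⟨
    - - (x * x)   ≈⟨ -‿involutive (x * x) ⟩
    x * x         ∎) (*-nonneg (0≤- x≤0) (0≤- x≤0))
    where open ≈

  0≤1 : 0# ≤ 1#
  0≤1 = ≤-respʳ (*-identityˡ 1#) (square≥0 1#)

  *-monoˡ-≤ : ∀ {x y} z → 0# ≤ z → x ≤ y → z * x ≤ z * y
  *-monoˡ-≤ {x} {y} z 0≤z x≤y = 0≤-⇒≤ (≤-respʳ (begin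
    z * (y - x)        ≈⟨ distribˡ z y (- x) ⟩
    z * y + z * - x    ≈⟨ +-congˡ (-‿distribʳ-* z x) ⟨
    z * y - z * x      ∎) (*-nonneg 0≤z (≤⇒0≤- x≤y)))
    where open ≈

  infixl 6 _⊓_ _⊔_

  _⊓_ _⊔_ : Carrier → Carrier → Carrier
  x ⊓ y with total x y
  ... | inj₁ _ = x
  ... | inj₂ _ = y
  x ⊔ y with total x y
  ... | inj₁ _ = y
  ... | inj₂ _ = x

  ⊓-elim : (P : Carrier → Set) → ∀ {x y} → (x ≤ y → P x) → (y ≤ x → P y) → P (x ⊓ y)
  ⊓-elim P {x} {y} px py with total x y
  ... | inj₁ x≤y = px x≤y
  ... | inj₂ y≤x = py y≤x

  ⊔-elim : (P : Carrier → Set) → ∀ {x y} → P x → P y → P (x ⊔ y)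
  ⊔-elim P {x} {y} px py with total x y
  ... | inj₁ _ = py
  ... | inj₂ _ = px

  ≤-⊔ˡ : ∀ x y → x ≤ x ⊔ y
  ≤-⊔ˡ x y with total x y
  ... | inj₁ x≤y = x≤y
  ... | inj₂ _ = ≤-refl

  ≤-⊔ʳ : ∀ x y → y ≤ x ⊔ y
  ≤-⊔ʳ x y with total x y
  ... | inj₁ _ = ≤-refl
  ... | inj₂ y≤x = y≤x

  fromℕ≥0 : ∀ n → 0# ≤ fromℕ n
  fromℕ≥0 zero    = ≤-refl
  fromℕ≥0 (suc n) = +-nonneg 0≤1 (fromℕ≥0 n)

  fromℕ-suc≉0 : ∀ n → ¬ fromℕ (suc n) ≈ 0#
  fromℕ-suc≉0 n n≈0 = 0≉1 (antisym 0≤1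
    (≤-respʳ n≈0 (≤-by (fromℕ≥0 n) refl)))

  -- Integer and rational constants in the field.

  private
    fromℤ : ℤ → Carrier
    fromℤ (+ n)    = fromℕ n
    fromℤ -[1+ n ] = - fromℕ (suc n)

    fromℤ-neg : ∀ i → fromℤ (ℤ.- i) ≈ - fromℤ i
    fromℤ-neg (+ zero)   = sym -0#≈0#
    fromℤ-neg (+ suc n)  = refl
    fromℤ-neg (-[1+ n ]) = sym (-‿involutive _)

    fromℤ-⊖ : ∀ m n → fromℤ (m ⊖ n) ≈ fromℕ m - fromℕ n
    fromℤ-⊖ m       zero    = sym (trans (+-congˡ -0#≈0#) (+-identityʳ _))
    fromℤ-⊖ zero    (suc n) = sym (+-identityˡ _)
    fromℤ-⊖ (suc m) (suc n) = begin
      fromℤ (suc m ⊖ suc n)              ≡⟨ ≡.cong fromℤ (ℤ.[1+m]⊖[1+n]≡m⊖n m n) ⟩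
      fromℤ (m ⊖ n)                      ≈⟨ fromℤ-⊖ m n ⟩
      fromℕ m - fromℕ n                  ≈⟨ +-identityˡ _ ⟨
      0# + (fromℕ m - fromℕ n)           ≈⟨ +-congʳ (-‿inverseʳ 1#) ⟨
      (1# - 1#) + (fromℕ m - fromℕ n)    ≈⟨ S.solve 4
          (λ a b c d → (a S.:+ b) S.:+ (c S.:+ d) S.:= (a S.:+ c) S.:+ (b S.:+ d)) refl 1#
          (- 1#) (fromℕ m) (- fromℕ n) ⟩
      (1# + fromℕ m) + (- 1# - fromℕ n)  ≈⟨ +-congˡ (-‿+-comm 1# (fromℕ n)) ⟩
      fromℕ (suc m) - fromℕ (suc n)      ∎
      where open ≈

    fromℤ-+ : ∀ i j → fromℤ (i ℤ.+ j) ≈ fromℤ i + fromℤ j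
    fromℤ-+ (+ m)    (+ n)    = ×-homo-+ 1# m n
    fromℤ-+ (+ m)    -[1+ n ] = fromℤ-⊖ m (suc n)
    fromℤ-+ -[1+ m ] (+ n)    = trans (fromℤ-⊖ n (suc m)) (+-comm _ _)
    fromℤ-+ -[1+ m ] -[1+ n ] = begin
      - fromℕ (suc (suc (m ℕ.+ n)))     ≈⟨ -‿cong (×-congˡ (≡.cong suc (ℕ.+-suc m n))) ⟨
      - fromℕ (suc m ℕ.+ suc n)         ≈⟨ -‿cong (×-homo-+ 1# (suc m) (suc n)) ⟩
      - (fromℕ (suc m) + fromℕ (suc n)) ≈⟨ -‿+-comm _ _ ⟨
      - fromℕ (suc m) - fromℕ (suc n)   ∎
      where open ≈

    signed : Sign → Carrier → Carrier
    signed Sign.+ x = x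
    signed Sign.- x = - x

    fromℤ-◃ : ∀ s n → fromℤ (s ◃ n) ≈ signed s (fromℕ n)
    fromℤ-◃ Sign.+ zero    = refl
    fromℤ-◃ Sign.- zero    = sym -0#≈0#
    fromℤ-◃ Sign.+ (suc n) = refl
    fromℤ-◃ Sign.- (suc n) = refl

    signed-* : ∀ s t x y → signed (s Sign.* t) (x * y) ≈ signed s x * signed t y
    signed-* Sign.+ Sign.+ x y = refl
    signed-* Sign.+ Sign.- x y = -‿distribʳ-* x y
    signed-* Sign.- Sign.+ x y = -‿distribˡ-* x y
    signed-* Sign.- Sign.- x y = begin
      x * y         ≈⟨ -‿involutive _ ⟨
      - - (x * y)   ≈⟨ -‿cong (-‿distribʳ-* x y) ⟩
      - (x * - y)   ≈⟨ -‿distribˡ-* x (- y) ⟩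
      - x * - y     ∎
      where open ≈

    fromℤ-signAbs : ∀ i → fromℤ i ≈ signed (ℤ.sign i) (fromℕ ℤ.∣ i ∣)
    fromℤ-signAbs (+ n)    = refl
    fromℤ-signAbs -[1+ n ] = refl

    signed-cong : ∀ s {x y} → x ≈ y → signed s x ≈ signed s y
    signed-cong Sign.+ x≈y = x≈y
    signed-cong Sign.- x≈y = -‿cong x≈y

    fromℤ-* : ∀ i j → fromℤ (i ℤ.* j) ≈ fromℤ i * fromℤ j
    fromℤ-* i j = begin
      fromℤ (i ℤ.* j)
        ≈⟨ fromℤ-◃ (ℤ.sign i Sign.* ℤ.sign j) (ℤ.∣ i ∣ ℕ.* ℤ.∣ j ∣) ⟩
      signed (ℤ.sign i Sign.* ℤ.sign j) (fromℕ (ℤ.∣ i ∣ ℕ.* ℤ.∣ j ∣))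
        ≈⟨ signed-cong (ℤ.sign i Sign.* ℤ.sign j) (×1-homo-* ℤ.∣ i ∣ ℤ.∣ j ∣) ⟩
      signed (ℤ.sign i Sign.* ℤ.sign j) (fromℕ ℤ.∣ i ∣ * fromℕ ℤ.∣ j ∣)
        ≈⟨ signed-* (ℤ.sign i) (ℤ.sign j) _ _ ⟩
      signed (ℤ.sign i) (fromℕ ℤ.∣ i ∣) * signed (ℤ.sign j) (fromℕ ℤ.∣ j ∣)
        ≈⟨ *-cong (fromℤ-signAbs i) (fromℤ-signAbs j) ⟨
      fromℤ i * fromℤ j ∎
      where open ≈

  -- A nonpositive inverse of `d ≥ 0` would make `d * - (d ⁻¹)`, which is -1, nonnegative.
  inverse≥0 : ∀ n → 0# ≤ fromℕ (suc n) ⁻¹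
  inverse≥0 n with total 0# (fromℕ (suc n) ⁻¹)
  ... | inj₁ 0≤d⁻¹ = 0≤d⁻¹
  ... | inj₂ d⁻¹≤0 = contradiction (antisym 0≤1 1≤0) 0≉1
    where
    d = fromℕ (suc n)
    1≤0 : 1# ≤ 0#
    1≤0 = 0≤-⇒≤ (≤-respʳ (begin
      d * - (d ⁻¹)  ≈⟨ -‿distribʳ-* d (d ⁻¹) ⟨
      - (d * d ⁻¹)  ≈⟨ -‿cong (*-inverseʳ (fromℕ-suc≉0 n)) ⟩
      - 1#          ≈⟨ +-identityˡ _ ⟨
      0# - 1#       ∎) (*-nonneg (fromℕ≥0 (suc n)) (0≤- d⁻¹≤0)))
      where open ≈

  private
    *-/-cancel : ∀ n x → fromℕ (suc n) * (x ÷ fromℕ (suc n)) ≈ x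
    *-/-cancel n x = begin
      d * (x * d ⁻¹) ≈⟨ S.solve 3 (λ a b c → a S.:* (b S.:* c) S.:= b S.:* (a S.:* c)) refl d x
          (d ⁻¹) ⟩
      x * (d * d ⁻¹) ≈⟨ *-congˡ (*-inverseʳ (fromℕ-suc≉0 n)) ⟩
      x * 1#         ≈⟨ *-identityʳ x ⟩
      x              ∎
      where
      open ≈
      d = fromℕ (suc n)

  -- Opaque, so that type checking never unfolds the unary numerals.
  opaque
    rat : ℚᵘ → Carrier
    rat q = fromℤ (↥ q) ÷ fromℕ (↧ₙ q)

    rat-fraction : ∀ n d → rat (mkℚᵘ (+ n) d) ≡ fromℕ n ÷ fromℕ (suc d)
    rat-fraction n d = ≡.refl

    rat-spec : ∀ q → fromℕ (↧ₙ q) * rat q ≈ fromℤ (↥ q)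
    rat-spec q = *-/-cancel (Unnormalised.ℚᵘ.denominator-1 q) (fromℤ (↥ q))

    -- The second argument is the denominator minus one: in the certificates below,
    -- `rat≥0 {63} {15}` stands for the constant 63/16.
    rat≥0 : ∀ {n d} → 0# ≤ rat (mkℚᵘ (+ n) d)
    rat≥0 {n} {d} = *-nonneg (fromℕ≥0 n) (inverse≥0 d)

  private
    *-cancel : ∀ d {x y} → fromℕ (suc d) * x ≈ fromℕ (suc d) * y → x ≈ y
    *-cancel d {x} {y} dx≈dy = begin
      x              ≈⟨ lemma x ⟨
      e ⁻¹ * (e * x) ≈⟨ *-congˡ dx≈dy ⟩
      e ⁻¹ * (e * y) ≈⟨ lemma y ⟩
      y              ∎
      where
      open ≈
      e = fromℕ (suc d)
      lemma : ∀ z → e ⁻¹ * (e * z) ≈ z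
      lemma z = begin
        e ⁻¹ * (e * z)  ≈⟨ S.solve 3 (λ a b c → a S.:* (b S.:* c) S.:= (b S.:* a) S.:* c) refl
            (e ⁻¹) e z ⟩
        (e * e ⁻¹) * z  ≈⟨ *-congʳ (*-inverseʳ (fromℕ-suc≉0 d)) ⟩
        1# * z          ≈⟨ *-identityˡ z ⟩
        z               ∎

    -- Denominators are invertible, so each homomorphism law for `rat` can be checked after clearing
    -- denominators.
    rat-unique : ∀ {n d z} → fromℕ (suc d) * z ≈ fromℤ n → rat (mkℚᵘ n d) ≈ z
    rat-unique {n} {d} spec = *-cancel d (trans (rat-spec (mkℚᵘ n d)) (sym spec))

    rat-cong : ∀ p q → ↥ p ℤ.* ↧ q ≡ ↥ q ℤ.* ↧ p → rat p ≈ rat q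
    rat-cong p@(mkℚᵘ n b) q@(mkℚᵘ m d) eq = rat-unique (*-cancel d (begin
      fromℕ (suc d) * (fromℕ (suc b) * rat q)  ≈⟨ S.solve 3
          (λ a b c → a S.:* (b S.:* c) S.:= (a S.:* c) S.:* b) refl (fromℕ (suc d))
          (fromℕ (suc b)) (rat q) ⟩
      fromℕ (suc d) * rat q * fromℕ (suc b)    ≈⟨ *-congʳ (rat-spec q) ⟩
      fromℤ m * fromℤ (+ suc b)                ≈⟨ fromℤ-* m (+ suc b) ⟨
      fromℤ (m ℤ.* + suc b)                    ≡⟨ ≡.cong fromℤ eq ⟨
      fromℤ (n ℤ.* + suc d)                    ≈⟨ fromℤ-* n (+ suc d) ⟩
      fromℤ n * fromℕ (suc d)                  ≈⟨ *-comm _ _ ⟩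
      fromℕ (suc d) * fromℤ n                  ∎))
      where open ≈

    rat-+ : ∀ p q → rat (p Unnormalised.+ q) ≈ rat p + rat q
    rat-+ p@(mkℚᵘ n b) q@(mkℚᵘ m d) = rat-unique (begin
      fromℕ (suc b ℕ.* suc d) * (rat p + rat q)
        ≈⟨ *-congʳ (×1-homo-* (suc b) (suc d)) ⟩
      fromℕ (suc b) * fromℕ (suc d) * (rat p + rat q)
        ≈⟨ S.solve 4 (λ b d p q → (b S.:* d) S.:* (p S.:+ q) S.:= (b S.:* p) S.:* d S.:+
            (d S.:* q) S.:* b) refl (fromℕ (suc b)) (fromℕ (suc d)) (rat p) (rat q) ⟩
      fromℕ (suc b) * rat p * fromℕ (suc d) + fromℕ (suc d) * rat q * fromℕ (suc b)
        ≈⟨ +-cong (*-congʳ (rat-spec p)) (*-congʳ (rat-spec q)) ⟩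
      fromℤ n * fromℕ (suc d) + fromℤ m * fromℕ (suc b)
        ≈⟨ +-cong (fromℤ-* n (+ suc d)) (fromℤ-* m (+ suc b)) ⟨
      fromℤ (n ℤ.* + suc d) + fromℤ (m ℤ.* + suc b)
        ≈⟨ fromℤ-+ (n ℤ.* + suc d) (m ℤ.* + suc b) ⟨
      fromℤ (n ℤ.* + suc d ℤ.+ m ℤ.* + suc b) ∎)
      where open ≈

    rat-* : ∀ p q → rat (p Unnormalised.* q) ≈ rat p * rat q
    rat-* p@(mkℚᵘ n b) q@(mkℚᵘ m d) = rat-unique (begin
      fromℕ (suc b ℕ.* suc d) * (rat p * rat q)
        ≈⟨ *-congʳ (×1-homo-* (suc b) (suc d)) ⟩
      fromℕ (suc b) * fromℕ (suc d) * (rat p * rat q)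
        ≈⟨ S.solve 4 (λ b d p q → (b S.:* d) S.:* (p S.:* q) S.:= (b S.:* p) S.:* (d S.:* q))
            refl (fromℕ (suc b)) (fromℕ (suc d)) (rat p) (rat q) ⟩
      fromℕ (suc b) * rat p * (fromℕ (suc d) * rat q)
        ≈⟨ *-cong (rat-spec p) (rat-spec q) ⟩
      fromℤ n * fromℤ m
        ≈⟨ fromℤ-* n m ⟨
      fromℤ (n ℤ.* m) ∎)
      where open ≈

    rat-neg : ∀ q → rat (Unnormalised.- q) ≈ - rat q
    rat-neg q@(mkℚᵘ n d) = rat-unique {ℤ.- n} {d} (begin
      fromℕ (suc d) * - rat q    ≈⟨ -‿distribʳ-* _ _ ⟨
      - (fromℕ (suc d) * rat q)  ≈⟨ -‿cong (rat-spec q) ⟩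
      - fromℤ n                  ≈⟨ fromℤ-neg n ⟨
      fromℤ (ℤ.- n)              ∎)
      where open ≈

  rat-0 : rat 0ℚᵘ ≈ 0#
  rat-0 = rat-unique {+ 0} {0} (zeroʳ _)

  rat-1 : rat 1ℚᵘ ≈ 1#
  rat-1 = rat-unique {+ 1} {0} (*-identityʳ _)

  -- A ring solver with rational coefficients.

  private
    -- The solver compares normal forms syntactically, so its coefficients
    -- have to be kept in lowest terms.
    reduce : ℚᵘ → ℚᵘ
    reduce q = ℚ.toℚᵘ (ℚ.fromℚᵘ q)

    rat-reduce : ∀ q → rat (reduce q) ≈ rat q
    rat-reduce q with ℚ.toℚᵘ-fromℚᵘ q
    ... | Unnormalised.*≡* eq = rat-cong (reduce q) q eq

  reducedRing : RawRing _ _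
  reducedRing = record
    { Carrier = ℚᵘ
    ; _≈_     = Unnormalised._≃_
    ; _+_     = λ p q → reduce (p Unnormalised.+ q)
    ; _*_     = λ p q → reduce (p Unnormalised.* q)
    ; -_      = Unnormalised.-_
    ; 0#      = 0ℚᵘ
    ; 1#      = 1ℚᵘ
    }

  rat-morphism : reducedRing -Raw-AlmostCommutative⟶ fromCommutativeRing commutativeRing
  rat-morphism = record
    { ⟦_⟧    = rat
    ; +-homo = λ p q → trans (rat-reduce (p Unnormalised.+ q)) (rat-+ p q)
    ; *-homo = λ p q → trans (rat-reduce (p Unnormalised.* q)) (rat-* p q)
    ; -‿homo = rat-neg
    ; 0-homo = rat-0
    ; 1-homo = rat-1
    }

  rat-weaklyDecidable : ∀ p q → Maybe (rat p ≈ rat q)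
  rat-weaklyDecidable p q with ↥ p ℤ.* ↧ q ℤ.≟ ↥ q ℤ.* ↧ p
  ... | yes eq = just (rat-cong p q eq)
  ... | no  _  = nothing

  module Solver = RingSolver reducedRing (fromCommutativeRing commutativeRing)
    rat-morphism rat-weaklyDecidable

  open Solver public using (solve; _:=_; _:+_; _:*_; _:-_; :-_; con; Polynomial)

  infix 9 _:/_

  _:/_ : ∀ {n} → ℕ → (d : ℕ) .{{_ : ℕ.NonZero d}} → Polynomial n
  p :/ q = con (+ p Unnormalised./ q)

  𝟘 𝟙 : ∀ {n} → Polynomial n
  𝟘 = con 0ℚᵘ
  𝟙 = con 1ℚᵘ

  infixl 6 _⊞_
  infixl 7 _⊠_

  _⊞_ : ∀ {x y} → 0# ≤ x → 0# ≤ y → 0# ≤ x + y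
  _⊞_ = +-nonneg

  _⊠_ : ∀ {x y} → 0# ≤ x → 0# ≤ y → 0# ≤ x * y
  _⊠_ = *-nonneg

-- Finite sums, distributions and expectations.

module Expectations (ℝ : Reals) where
  open Reals ℝ hiding (_/_) renaming (zero to *-zero)
  open LoadBalancing ℝ
  open Field ℝ
  open SemiringMult semiring using (×-assoc-*)
  open SemiringSum semiring public
    using (sum-cong-≋; ∑-distrib-+; *-distribˡ-sum; *-distribʳ-sum; sum-replicate;
        sum-replicate-zero)
  private module ≈ = SetoidReasoning setoid

  sum-mono : ∀ {n} {f g : Fin n → Carrier} → (∀ i → f i ≤ g i) → sum f ≤ sum g
  sum-mono {zero}  f≤g = ≤-refl
  sum-mono {suc n} f≤g = +-mono-≤ (f≤g zero) (sum-mono (f≤g ∘ suc))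

  sum-++ : ∀ m {n} (f : Fin (m ℕ.+ n) → Carrier) →
           sum f ≈ sum (λ i → f (i ↑ˡ n)) + sum (λ j → f (m ↑ʳ j))
  sum-++ zero    f = sym (+-identityˡ _)
  sum-++ (suc m) f = trans (+-congˡ (sum-++ m (f ∘ suc))) (sym (+-assoc _ _ _))

  sum-combine : ∀ m n (f : Fin (m ℕ.* n) → Carrier) →
                sum f ≈ sum {m} (λ i → sum {n} (λ j → f (combine i j)))
  sum-combine zero    n f = refl
  sum-combine (suc m) n f = trans (sum-++ n {m ℕ.* n} f)
      (+-congˡ (sum-combine m n (λ (k : Fin (m ℕ.* n)) → f (n ↑ʳ k))))

  sum-remQuot : ∀ m n (f : Fin m × Fin n → Carrier) →
                sum (λ k → f (remQuot n k)) ≈ sum (λ i → sum (λ j → f (i , j)))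
  sum-remQuot m n f = trans (sum-combine m n (λ k → f (remQuot n k)))
      (sum-cong-≋ {m} λ i → sum-cong-≋ {n} λ j →
    reflexive (≡.cong f (remQuot-combine i j)))

  -- The index is one less than the number of outcomes, which excludes empty support.
  uniform : ∀ n → Distribution (Fin (suc n))
  uniform n = record
    { size    = suc n
    ; outcome = λ k → k
    ; prob    = λ _ → p
    ; prob≥0  = λ _ → rat≥0
    ; sum≈1   = begin
        sum {suc n} (λ _ → p)     ≈⟨ sum-replicate (suc n) ⟩
        p + n · p                 ≈⟨ +-cong (*-identityˡ p) (·-* n) ⟨
        1# * p + fromℕ n * p      ≈⟨ distribʳ p 1# (fromℕ n) ⟨
        fromℕ (suc n) * p         ≈⟨ rat-spec (mkℚᵘ (+ 1) n) ⟩
        1# + 0#                   ≈⟨ +-identityʳ 1# ⟩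
        1#                        ∎
    }
    where
    open ≈
    open SemiringMult semiring using () renaming (_×_ to _·_)
    p = rat (mkℚᵘ (+ 1) n)
    ·-* : ∀ n → fromℕ n * p ≈ n · p
    ·-* n = trans (×-assoc-* n 1# p) (SemiringMult.×-congʳ semiring n (*-identityˡ p))

  mapᴰ : {A B : Set} → (A → B) → Distribution A → Distribution B
  mapᴰ f D = record
    { size = size ; outcome = f ∘ outcome ; prob = prob ; prob≥0 = prob≥0 ; sum≈1 = sum≈1 }
    where open Distribution D

  product : {A B : Set} → Distribution A → Distribution B → Distribution (A × B)
  product D D′ = record
    { size    = D.size ℕ.* D′.size
    ; outcome = λ k → let (i , j) = remQuot D′.size k in D.outcome i , D′.outcome j
    ; prob    = λ k → let (i , j) = remQuot D′.size k in D.prob i * D′.prob j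
    ; prob≥0  = λ k → *-nonneg (D.prob≥0 _) (D′.prob≥0 _)
    ; sum≈1   = begin
        sum (λ k → let (i , j) = remQuot D′.size k in D.prob i * D′.prob j)
          ≈⟨ sum-remQuot D.size D′.size (λ (i , j) → D.prob i * D′.prob j) ⟩
        sum (λ i → sum (λ j → D.prob i * D′.prob j))
          ≈⟨ sum-cong-≋ {D.size} (λ i → begin
               sum (λ j → D.prob i * D′.prob j)  ≈⟨ *-distribˡ-sum (D.prob i) D′.prob ⟨
               D.prob i * sum D′.prob            ≈⟨ *-congˡ D′.sum≈1 ⟩
               D.prob i * 1#                     ≈⟨ *-identityʳ _ ⟩
               D.prob i                          ∎) ⟩
        sum D.prob
          ≈⟨ D.sum≈1 ⟩
        1# ∎
    }
    where
    open ≈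
    module D  = Distribution D
    module D′ = Distribution D′

  𝔼-product : {A B : Set} (D : Distribution A) (D′ : Distribution B) (f : A × B → Carrier) →
              𝔼 (product D D′) f ≈ 𝔼 D λ a → 𝔼 D′ λ b → f (a , b)
  𝔼-product D D′ f = begin
    𝔼 (product D D′) f
      ≈⟨ sum-remQuot D.size D′.size (λ (i , j) →
          D.prob i * D′.prob j * f (D.outcome i , D′.outcome j)) ⟩
    sum (λ i → sum (λ j → D.prob i * D′.prob j * f (D.outcome i , D′.outcome j)))
      ≈⟨ sum-cong-≋ {D.size} (λ i → trans (sum-cong-≋ {D′.size} (λ j → *-assoc _ _ _))
           (sym (*-distribˡ-sum {D′.size} (D.prob i) _))) ⟩
    𝔼 D (λ a → 𝔼 D′ λ b → f (a , b)) ∎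
    where
    open ≈
    module D  = Distribution D
    module D′ = Distribution D′

  -- A normalised positive linear functional. The moment calculations use nothing else, and
  -- composing functionals by `>>=` avoids constructing joint distributions of loads and tokens.
  record Expectation (A : Set) : Set₁ where
    field
      E       : (A → Carrier) → Carrier
      E-mono  : ∀ {f g} → (∀ a → f a ≤ g a) → E f ≤ E g
      E-+     : ∀ f g → E (λ a → f a + g a) ≈ E f + E g
      E-*     : ∀ c f → E (λ a → c * f a) ≈ c * E f
      E-const : ∀ c → E (λ _ → c) ≈ c

    E-cong : ∀ {f g} → (∀ a → f a ≈ g a) → E f ≈ E g
    E-cong f≈g = antisym (E-mono (λ a → ≤-reflexive (f≈g a)))
                         (E-mono (λ a → ≤-reflexive (sym (f≈g a))))

    E-sum : ∀ {n} (f : Fin n → A → Carrier) → E (λ a → sum (λ i → f i a)) ≈ sum (λ i → E (f i))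
    E-sum {zero}  f = E-const 0#
    E-sum {suc n} f = trans (E-+ _ _) (+-congˡ (E-sum (f ∘ suc)))

    -- Fubini with one finite side: linearity suffices.
    E-𝔼 : {B : Set} (D : Distribution B) (f : A → B → Carrier) →
          E (λ a → 𝔼 D (f a)) ≈ 𝔼 D (λ b → E (λ a → f a b))
    E-𝔼 D f = trans (E-sum (λ k a → prob k * f a (outcome k)))
        (sum-cong-≋ {size} λ k → E-* (prob k) _)
      where open Distribution D

  open Expectation public

  finite : {A : Set} → Distribution A → Expectation A
  finite D = record
    { E       = 𝔼 D
    ; E-mono  = λ f≤g → sum-mono (λ k → *-monoˡ-≤ (prob k) (prob≥0 k) (f≤g (outcome k)))
    ; E-+     = λ f g → trans (sum-cong-≋ {size} (λ k → distribˡ (prob k) _ _))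
        (∑-distrib-+ (λ k → prob k * f (outcome k)) _)
    ; E-*     = λ c f → trans (sum-cong-≋ {size} (λ k → x∙yz≈y∙xz (prob k) c (f (outcome k))))
                              (sym (*-distribˡ-sum c (λ k → prob k * f (outcome k))))
    ; E-const = λ c → trans (sym (*-distribʳ-sum c prob))
        (trans (*-congʳ sum≈1) (*-identityˡ c))
    }
    where
    open Distribution D
    open import Algebra.Properties.CommutativeSemigroup *-commutativeSemigroup using (x∙yz≈y∙xz)

  dirac : {A : Set} → A → Expectation A
  dirac a = record
    { E       = λ f → f a
    ; E-mono  = λ f≤g → f≤g a
    ; E-+     = λ _ _ → refl
    ; E-*     = λ _ _ → refl
    ; E-const = λ _ → refl
    }

  infixl 1 _>>=_

  _>>=_ : {A B : Set} → Expectation A → (A → Expectation B) → Expectation B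
  X >>= k = record
    { E       = λ f → E X (λ a → E (k a) f)
    ; E-mono  = λ f≤g → E-mono X (λ a → E-mono (k a) f≤g)
    ; E-+     = λ f g → trans (E-cong X (λ a → E-+ (k a) f g)) (E-+ X _ _)
    ; E-*     = λ c f → trans (E-cong X (λ a → E-* (k a) c f)) (E-* X c _)
    ; E-const = λ c → trans (E-cong X (λ a → E-const (k a) c)) (E-const X c)
    }

-- Minima over finite choices, and the algorithm itself.

module Algorithm (ℝ : Reals) where
  open Reals ℝ hiding (_/_) renaming (zero to *-zero)
  open Unnormalised using (_/_)
  open LoadBalancing ℝ
  open Field ℝ
  open Expectations ℝ

  HasMinimum : Set → Set
  HasMinimum A = (f : A → Carrier) → ∃ λ x → ∀ y → f x ≤ f y

  private
    -- Nonemptiness is not inherited by the tail of a subset, so the recursion carries the empty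
    -- case as an alternative.
    minimum-⊎ : ∀ {n} (p : Subset n) → HasMinimum (∃ (_∈ p)) ⊎ (∀ x → ¬ x ∈ p)
    minimum-⊎ []            = inj₂ λ _ ()
    minimum-⊎ (outside ∷ p) with minimum-⊎ p
    ... | inj₂ empty = inj₂ λ { (suc x) (there x∈p) → empty x x∈p }
    ... | inj₁ min   = inj₁ λ f →
      let ((x , x∈p) , least) = min (λ (x , x∈p) → f (suc x , there x∈p))
      in (suc x , there x∈p) , λ { (suc y , there y∈p) → least (y , y∈p) }
    minimum-⊎ (inside ∷ p) with minimum-⊎ p
    ... | inj₂ empty = inj₁ λ f → (zero , here) ,
      λ { (zero , here) → ≤-refl ; (suc y , there y∈p) → contradiction y∈p (empty y) }
    ... | inj₁ min   = inj₁ λ f → best f (min (λ (x , x∈p) → f (suc x , there x∈p)))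
      where
      best : (f : ∃ (_∈ inside ∷ p) → Carrier) →
             (∃ λ x → ∀ (y : ∃ (_∈ p)) → f (suc (proj₁ x) , there (proj₂ x)) ≤
                 f (suc (proj₁ y) , there (proj₂ y))) →
             ∃ λ x → ∀ y → f x ≤ f y
      best f ((x , x∈p) , least) with total (f (zero , here)) (f (suc x , there x∈p))
      ... | inj₁ z≤x = (zero , here) ,
        λ { (zero , here) → ≤-refl ; (suc y , there y∈p) → ≤-trans z≤x (least (y , y∈p)) }
      ... | inj₂ x≤z = (suc x , there x∈p) ,
        λ { (zero , here) → x≤z ; (suc y , there y∈p) → least (y , y∈p) }

  minimum-∈ : ∀ {n} {p : Subset n} → Nonempty p → HasMinimum (∃ (_∈ p))
  minimum-∈ {p = p} (x , x∈p) with minimum-⊎ p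
  ... | inj₁ min   = min
  ... | inj₂ empty = contradiction x∈p (empty x)

  -- Backward induction: the remaining jobs are optimised for each choice of the first machine, then
  -- that choice is optimised.
  minimum-Assignment : ∀ {m} (jobs : Instance m) → HasMinimum (Assignment jobs)
  minimum-Assignment []         f = [] , λ { [] → ≤-refl }
  minimum-Assignment (j ∷ jobs) f =
    let rest s              = minimum-Assignment jobs (λ x → f (s ∷ x))
        (s , s-least)       = minimum-∈ (Job.nonempty j) (λ s → f (s ∷ proj₁ (rest s)))
    in s ∷ proj₁ (rest s) , λ { (t ∷ x) → ≤-trans (s-least t) (proj₂ (rest t) x) }

  -- The values are written with `rat` instead of `0#` and `1#`, so that after a case split they are
  -- the solver constants `𝟘` and `𝟙`.
  δ : ∀ {m} → Fin m → Fin m → Carrier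
  δ a i with a ≟ i
  ... | yes _ = rat 1ℚᵘ
  ... | no  _ = rat 0ℚᵘ

  δ-elim : ∀ {m} (P : Carrier → Set) {a i : Fin m} → (a ≡ i → P (rat 1ℚᵘ)) →
      (a ≢ i → P (rat 0ℚᵘ)) → P (δ a i)
  δ-elim P {a} {i} p₁ p₀ with a ≟ i
  ... | yes a≡i = p₁ a≡i
  ... | no  a≢i = p₀ a≢i

  -- Zero on infeasible machines.
  weightAt : ∀ {m} → Job m → Fin m → Carrier
  weightAt j i with i ∈? Job.feasible j
  ... | yes i∈ = Job.weight j (i , i∈)
  ... | no  _  = 0#

  weightAt≥0 : ∀ {m} (j : Job m) i → 0# ≤ weightAt j i
  weightAt≥0 j i with i ∈? Job.feasible j
  ... | yes i∈ = Job.weight≥0 j (i , i∈)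
  ... | no  _  = ≤-refl

  weightAt-feasible : ∀ {m} (j : Job m) (s : FeasibleMachine j) →
      weightAt j (proj₁ s) ≡ Job.weight j s
  weightAt-feasible j (i , i∈) with i ∈? Job.feasible j
  ... | yes i∈′ = ≡.cong (λ z → Job.weight j (i , z)) ([]=-irrelevant i∈′ i∈)
  ... | no  i∉  = contradiction i∈ i∉

  contribution-δ : ∀ {m} (j : Job m) (s : FeasibleMachine j) i →
                   contribution j s i ≈ weightAt j i * δ (proj₁ s) i
  contribution-δ j s i with proj₁ s ≟ i
  ... | yes ≡.refl = trans (reflexive (≡.sym (weightAt-feasible j s)))
      (sym (trans (*-congˡ rat-1) (*-identityʳ _)))
  ... | no  _      = sym (trans (*-congˡ rat-0) (zeroʳ _))

  h : Carrier
  h = rat (mkℚᵘ (+ 1) 63)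

  module _ (engaged : Bool) where
    slope : Carrier
    slope = if engaged then rat (+ 63 / 16) else rat (+ 4 / 1)

    -- In 33/32 the 1 pays for the term `w * w` in the second moment. The extra 1/32 equals
    -- `4 * h / 2` and covers the loss from evaluating prices at the left end of each chunk.
    price : (L w x : Carrier) → Carrier
    price L w x = slope * (L + w * x) * w + rat (+ 33 / 32) * (w * w)

    -- The sum of price L w (k h) h over the chunks k h < x.
    chunkCost : (L w x : Carrier) → Carrier
    chunkCost L w x = slope * (L * w * x + rat (+ 1 / 2) * (w * w) * (x * x - h * x))
                    + rat (+ 33 / 32) * (w * w) * x

    -- The first term is the recursion followed by E[R i * S i] itself: with probability `x` the
    -- token is renewed, which discards the old correlation and creates `w * (1 - x) / 4`. The cap
    -- at 1/16 of the new load keeps `16 K ≤ L`.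
    nextCorrelation : (L K w x : Carrier) → Carrier
    nextCorrelation L K w x =
      if engaged
      then (rat 1ℚᵘ - x) * (K + rat (+ 1 / 4) * (w * x)) ⊓ rat (+ 1 / 16) * (L + w * x)
      else K

  share : ∀ {m n} → (Fin n → Fin m) → Fin m → Carrier
  share {n = n} c i = sum {n} λ k → h * δ (c k) i

  -- ⊙ records no coin.
  data Token : Set where
    ⊕ ⊖ ⊙ : Token

  value : Token → Carrier
  value ⊕ = rat 1ℚᵘ
  value ⊖ = - rat 1ℚᵘ
  value ⊙ = rat 0ℚᵘ

  -- Only `token` is random; the other two fields are determined by the jobs seen so far. The
  -- realised loads are not stored.
  record Memory (m : ℕ) : Set where
    constructor memory
    field
      fractionalLoad : Fin m → Carrier
      correlation    : Fin m → Carrier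
      token          : Fin m → Token

  -- An engaged machine either decides by a fresh fair coin, which its token
  -- then records (⊕: the job went to that machine), or spends the recorded coin by deciding
  -- the opposite way.  Averaged over the token, the choice is fair.
  respond : (engaged : Bool) → Token → Fin 4 → Token × Bool
  respond false t 0F            = t , true
  respond false t 1F            = t , false
  respond false t 2F            = t , true
  respond false t 3F            = t , false
  respond true  t 0F            = ⊕ , true
  respond true  t 1F            = ⊖ , false
  respond true  ⊕ (suc (suc _)) = ⊙ , false
  respond true  ⊖ (suc (suc _)) = ⊙ , true
  respond true  ⊙ 2F            = ⊙ , true
  respond true  ⊙ 3F            = ⊙ , false

  Coins : Set
  Coins = Fin 64 × Fin 64 × Fin 4

  -- Opaque, so that sums over all outcomes are not unfolded.
  opaque
    draw : Distribution (Fin 64)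
    draw = uniform 63

    flip : Distribution (Fin 4)
    flip = uniform 3

    share-draw : ∀ {m} (c : Fin 64 → Fin m) i → share c i ≡ 𝔼 draw (λ k → δ (c k) i)
    share-draw c i = ≡.refl

    𝔼-flip : ∀ f → 𝔼 flip f ≡ 𝔼 (uniform 3) f
    𝔼-flip f = ≡.refl

  coins : Distribution Coins
  coins = product draw (product draw flip)

  module Round {m : ℕ} (L K : Fin m → Carrier) (j : Job m) where
    w : Fin m → Carrier
    w = weightAt j

    engaged : Fin m → Bool
    engaged i = does (rat (+ 3 / 1) * L i ≤? rat (+ 8 / 1) * w i)

    cheapest : (x : Fin m → Carrier) →
               ∃ λ (s : FeasibleMachine j) → ∀ (t : FeasibleMachine j) →
                 let p (i , _) = price (engaged i) (L i) (w i) (x i) in p s ≤ p t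
    cheapest x = minimum-∈ (Job.nonempty j) λ (i , _) → price (engaged i) (L i) (w i) (x i)

    -- The newest chunk has index `zero`, so `chunks n` is exactly the state in which the next chunk
    -- is priced.
    chunks : ∀ n → Fin n → FeasibleMachine j
    chunks (suc n) zero    = proj₁ (cheapest (share (proj₁ ∘ chunks n)))
    chunks (suc n) (suc k) = chunks n k

    chunk : Fin 64 → FeasibleMachine j
    chunk = chunks 64

    x : Fin m → Carrier
    x = share (proj₁ ∘ chunk)

    L′ K′ : Fin m → Carrier
    L′ i = L i + w i * x i
    K′ i = nextCorrelation (engaged i) (L i) (K i) (w i) (x i)

    decide : (Fin m → Token) → (a b : FeasibleMachine j) → Fin 4 →
        (Fin m → Token) × FeasibleMachine j
    decide token a b c =
      let (t , follow) = respond (engaged (proj₁ a)) (token (proj₁ a)) c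
      in updateAt token (proj₁ a) (const t) , (if follow then a else b)

    next : Memory m → Coins → Memory m × FeasibleMachine j
    next (memory _ _ token) (p , q , c) =
      let (token′ , s) = decide token (chunk p) (chunk q) c in memory L′ K′ token′ , s

  algorithm : (m : ℕ) → RandomizedOnlineAlgorithm m
  algorithm m = record
    { Memory  = Memory m
    ; initial = mapᴰ (λ _ → memory (λ _ → 0#) (λ _ → 0#) (λ _ → ⊙)) (uniform 0)
    ; step    = λ (memory L K token) j → mapᴰ (Round.next L K j (memory L K token)) coins
    }

-- Polynomial inequalities behind the constants.

module Estimates (ℝ : Reals) where
  open Reals ℝ hiding (_/_) renaming (zero to *-zero)
  open Unnormalised using (_/_)
  open Field ℝ
  open Algorithm ℝ

  ε : Bool → Carrier
  ε true  = rat 1ℚᵘ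
  ε false = rat 0ℚᵘ

  -- The saving over independent rounding in the second moment of a load.
  gain : Bool → (K w x : Carrier) → Carrier
  gain e K w x = ε e * (rat (+ 1 / 2) * (w * x) * ((rat 1ℚᵘ - x) * K))

  slope≥0 : ∀ e → 0# ≤ slope e
  slope≥0 true  = rat≥0
  slope≥0 false = rat≥0

  price-mono : ∀ e L {w x y} → 0# ≤ w → x ≤ y → price e L w x ≤ price e L w y
  price-mono e L {w} {x} {y} w≥0 x≤y = ≤-by
    (slope≥0 e ⊠ (w≥0 ⊠ ≤⇒0≤- x≤y) ⊠ w≥0)
    (solve 5 (λ s L w x y → s :* (L :+ w :* y) :* w :+ 33 :/ 32 :* (w :* w) :=
        s :* (L :+ w :* x) :* w :+ 33 :/ 32 :* (w :* w) :+ s :* (w :* (y :- x)) :* w) refl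
        (slope e) L w x y)

  chunkCost-0 : ∀ e L w → chunkCost e L w 0# ≈ 0#
  chunkCost-0 e L w = trans
    (solve 4 (λ s L w x → s :* (L :* w :* x :+ 1 :/ 2 :* (w :* w) :* (x :* x :- 1 :/ 64 :* x))
        :+ 33 :/ 32 :* (w :* w) :* x :=
        x :* (s :* (L :* w :+ 1 :/ 2 :* (w :* w) :* (x :- 1 :/ 64))
        :+ 33 :/ 32 :* (w :* w))) refl (slope e) L w 0#)
    (zeroˡ _)

  -- `chunkCost` is quadratic in the share, so the identity depends on `δ a i` being 0 or 1 and is
  -- checked for both values.
  chunkCost-step : ∀ {m} (a i : Fin m) e L w x →
    chunkCost e L w (h * δ a i + x) ≈ h * (δ a i * price e L w x) + chunkCost e L w x
  chunkCost-step a i e L w x = δ-elim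
    (λ d → chunkCost e L w (h * d + x) ≈ h * (d * price e L w x) + chunkCost e L w x) {a} {i}
    (λ _ → solve 4 (λ s L w x → s :* (L :* w :* (1 :/ 64 :* 𝟙 :+ x)
        :+ 1 :/ 2 :* (w :* w) :* ((1 :/ 64 :* 𝟙 :+ x) :* (1 :/ 64 :* 𝟙 :+ x)
        :- 1 :/ 64 :* (1 :/ 64 :* 𝟙 :+ x))) :+ 33 :/ 32 :* (w :* w) :* (1 :/ 64 :* 𝟙 :+ x)
        := 1 :/ 64 :* (𝟙 :* (s :* (L :+ w :* x) :* w :+ 33 :/ 32 :* (w :* w)))
        :+ (s :* (L :* w :* x :+ 1 :/ 2 :* (w :* w) :* (x :* x :- 1 :/ 64 :* x))
        :+ 33 :/ 32 :* (w :* w) :* x)) refl (slope e) L w x)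
    (λ _ → solve 4 (λ s L w x → s :* (L :* w :* (1 :/ 64 :* 𝟘 :+ x)
        :+ 1 :/ 2 :* (w :* w) :* ((1 :/ 64 :* 𝟘 :+ x) :* (1 :/ 64 :* 𝟘 :+ x)
        :- 1 :/ 64 :* (1 :/ 64 :* 𝟘 :+ x))) :+ 33 :/ 32 :* (w :* w) :* (1 :/ 64 :* 𝟘 :+ x)
        := 1 :/ 64 :* (𝟘 :* (s :* (L :+ w :* x) :* w :+ 33 :/ 32 :* (w :* w)))
        :+ (s :* (L :* w :* x :+ 1 :/ 2 :* (w :* w) :* (x :* x :- 1 :/ 64 :* x))
        :+ 33 :/ 32 :* (w :* w) :* x)) refl (slope e) L w x)

  module _ {L K w x : Carrier} (K≥0 : 0# ≤ K) (16K≤L : rat (+ 16 / 1) * K ≤ L)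
           (w≥0 : 0# ≤ w) (x≥0 : 0# ≤ x) (x≤1 : x ≤ rat 1ℚᵘ) where

    private
      p₁ = ≤⇒0≤- x≤1
      p₂ = ≤⇒0≤- 16K≤L

      L≥0 : 0# ≤ L
      L≥0 = ≤-trans (rat≥0 ⊠ K≥0) 16K≤L

    nextCorrelation≥0 : ∀ e → 0# ≤ nextCorrelation e L K w x
    nextCorrelation≥0 false = K≥0
    nextCorrelation≥0 true  = ⊓-elim (0# ≤_)
      (λ _ → p₁ ⊠ (K≥0 ⊞ rat≥0 ⊠ (w≥0 ⊠ x≥0)))
      (λ _ → rat≥0 ⊠ (L≥0 ⊞ w≥0 ⊠ x≥0))

    nextCorrelation-bound : ∀ e → rat (+ 16 / 1) * nextCorrelation e L K w x ≤ L + w * x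
    nextCorrelation-bound false = ≤-by (p₂ ⊞ w≥0 ⊠ x≥0)
      (solve 4 (λ L K w x → L :+ w :* x := 16 :/ 1 :* K :+ ((L :- 16 :/ 1 :* K) :+ w :* x)) refl
          L K w x)
    nextCorrelation-bound true  = ⊓-elim (λ K′ → rat (+ 16 / 1) * K′ ≤ L + w * x)
      (λ c₁≤c₂ → ≤-by (rat≥0 {16} {0} ⊠ ≤⇒0≤- c₁≤c₂)
        (solve 4 (λ L K w x → L :+ w :* x :=
            16 :/ 1 :* ((𝟙 :- x) :* (K :+ 1 :/ 4 :* (w :* x)))
            :+ 16 :/ 1 :* (1 :/ 16 :* (L :+ w :* x)
            :- (𝟙 :- x) :* (K :+ 1 :/ 4 :* (w :* x)))) refl L K w x))
      (λ _ → ≤-reflexive (solve 3 (λ L w x → 16 :/ 1 :* (1 :/ 16 :* (L :+ w :* x)) :=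
          L :+ w :* x) refl L w x))

    -- The one-machine form of the potential argument: `Q` and `Q′` are the second moments of the
    -- load before and after the job.
    potential-step : ∀ e {Q Q′} → (e ≡ true → rat (+ 3 / 1) * L ≤ rat (+ 8 / 1) * w) →
      Q′ + gain e K w x ≤ Q + (rat (+ 2 / 1) * L + w) * (w * x) →
      Q′ + (L + w * x) * (L + w * x) - rat (+ 1 / 4) * ((L + w * x) * nextCorrelation e L K w x)
        ≤ Q + L * L - rat (+ 1 / 4) * (L * K) + chunkCost e L w x
    potential-step false {Q} {Q′} _ Q′≤ = ≤-by
      (≤⇒0≤- Q′≤ ⊞ (w≥0 ⊠ w≥0 ⊠ (x≥0 ⊠ x≥0) ⊞ rat≥0 {1} {3} ⊠ (w≥0 ⊠ x≥0 ⊠ K≥0)))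
      (solve 6 (λ L K w x Q R → Q :+ L :* L :- 1 :/ 4 :* (L :* K)
          :+ (4 :/ 1 :* (L :* w :* x :+ 1 :/ 2 :* (w :* w) :* (x :* x :- 1 :/ 64 :* x))
          :+ 33 :/ 32 :* (w :* w) :* x) :=
          R :+ (L :+ w :* x) :* (L :+ w :* x) :- 1 :/ 4 :* ((L :+ w :* x) :* K)
          :+ ((Q :+ (2 :/ 1 :* L :+ w) :* (w :* x)
          :- (R :+ 𝟘 :* (1 :/ 2 :* (w :* x) :* ((𝟙 :- x) :* K))))
          :+ (w :* w :* (x :* x) :+ 1 :/ 4 :* (w :* x :* K)))) refl L K w x
          Q Q′)
    potential-step true {Q} {Q′} engaged Q′≤ = ⊓-elim
      (λ K′ → Q′ + (L + w * x) * (L + w * x) - rat (+ 1 / 4) * ((L + w * x) * K′)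
        ≤ Q + L * L - rat (+ 1 / 4) * (L * K) + chunkCost true L w x)
      -- To first order in `x`, the gain and the growth of `L K / 4` together save
      -- `x * (3/4 w K + 1/16 L w - 1/4 L K)`. The term `L w / 16` pays for lowering the slope from
      -- 4 to 63/16, and `3 L ≤ 8 w` bounds `L K / 4` by `2/3 w K`.
      (λ _ → ≤-by
        (≤⇒0≤- Q′≤ ⊞
          (x≥0 ⊠ (rat≥0 {1} {11} ⊠ (K≥0 ⊠ p₃) ⊞ rat≥0 {1} {47} ⊠ (w≥0 ⊠ x≥0 ⊠ p₃)
                 ⊞ rat≥0 {1} {11} ⊠ (w≥0 ⊠ K≥0) ⊞ rat≥0 {1} {15} ⊠ (w≥0 ⊠ w≥0 ⊠ (x≥0 ⊠ p₁))
                 ⊞ rat≥0 {3} {3} ⊠ (w≥0 ⊠ x≥0 ⊠ (rat≥0 {1} {15} ⊠ p₂ ⊞ rat≥0 {1} {47} ⊠ p₃))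
                 ⊞ rat≥0 {65} {95} ⊠ (w≥0 ⊠ w≥0 ⊠ x≥0))
          ⊞ rat≥0 {1} {2047} ⊠ (w≥0 ⊠ w≥0 ⊠ x≥0)))
        (solve 6 (λ L K w x Q R → Q :+ L :* L :- 1 :/ 4 :* (L :* K)
            :+ (63 :/ 16 :* (L :* w :* x :+ 1 :/ 2 :* (w :* w) :* (x :* x :- 1 :/ 64 :* x))
            :+ 33 :/ 32 :* (w :* w) :* x) :=
            R :+ (L :+ w :* x) :* (L :+ w :* x)
            :- 1 :/ 4 :* ((L :+ w :* x) :* ((𝟙 :- x) :* (K :+ 1 :/ 4 :* (w :* x))))
            :+ ((Q :+ (2 :/ 1 :* L :+ w) :* (w :* x)
            :- (R :+ 𝟙 :* (1 :/ 2 :* (w :* x) :* ((𝟙 :- x) :* K))))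
            :+ (x :* (1 :/ 12 :* (K :* (8 :/ 1 :* w :- 3 :/ 1 :* L))
            :+ 1 :/ 48 :* (w :* x :* (8 :/ 1 :* w :- 3 :/ 1 :* L))
            :+ 1 :/ 12 :* (w :* K) :+ 1 :/ 16 :* (w :* w :* (x :* (𝟙
            :- x))) :+ 3 :/ 4 :* (w :* x :* (1 :/ 16 :* (L
            :- 16 :/ 1 :* K) :+ 1 :/ 48 :* (8 :/ 1 :* w
            :- 3 :/ 1 :* L))) :+ 65 :/ 96 :* (w :* w :* x))
            :+ 1 :/ 2048 :* (w :* w :* x)))) refl L K w x Q Q′))
      -- With the capped correlation the potential alone gives slope 127/32. The missing 1/32 comes
      -- from the gain, since `c₂≤c₁` bounds `(1 - x) K` below by
      -- `(L + w x) / 16 - (1 - x) w x / 4`.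
      (λ c₂≤c₁ → ≤-by
        (≤⇒0≤- Q′≤ ⊞
          (rat≥0 {1} {1} ⊠ (w≥0 ⊠ x≥0 ⊠ ≤⇒0≤- c₂≤c₁) ⊞ rat≥0 {1} {63} ⊠ (L≥0 ⊠ p₂)
          ⊞ rat≥0 {57} {63} ⊠ (w≥0 ⊠ w≥0 ⊠ (x≥0 ⊠ x≥0))
              ⊞ rat≥0 {1} {7} ⊠ (w≥0 ⊠ w≥0 ⊠ (x≥0 ⊠ x≥0 ⊠ x≥0))
          ⊞ rat≥0 {1} {2047} ⊠ (w≥0 ⊠ w≥0 ⊠ x≥0)))
        (solve 6 (λ L K w x Q R → Q :+ L :* L :- 1 :/ 4 :* (L :* K)
            :+ (63 :/ 16 :* (L :* w :* x :+ 1 :/ 2 :* (w :* w) :* (x :* x :- 1 :/ 64 :* x))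
            :+ 33 :/ 32 :* (w :* w) :* x) :=
            R :+ (L :+ w :* x) :* (L :+ w :* x)
            :- 1 :/ 4 :* ((L :+ w :* x) :* (1 :/ 16 :* (L :+ w :* x)))
            :+ ((Q :+ (2 :/ 1 :* L :+ w) :* (w :* x)
            :- (R :+ 𝟙 :* (1 :/ 2 :* (w :* x) :* ((𝟙 :- x) :* K))))
            :+ (1 :/ 2 :* (w :* x :* ((𝟙 :- x) :* (K
            :+ 1 :/ 4 :* (w :* x)) :- 1 :/ 16 :* (L :+ w :* x)))
            :+ 1 :/ 64 :* (L :* (L :- 16 :/ 1 :* K))
            :+ 57 :/ 64 :* (w :* w :* (x :* x))
            :+ 1 :/ 8 :* (w :* w :* (x :* x :* x))
            :+ 1 :/ 2048 :* (w :* w :* x)))) refl L K w x Q Q′))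
      where p₃ = ≤⇒0≤- (engaged ≡.refl)

  -- An upper bound on what is paid per unit of weight on a machine with final
  -- fractional load L and load T in the optimum; the first alternative covers
  -- jobs for which the machine is engaged, the second those for which it is not.
  rate : (T L : Carrier) → Carrier
  rate T L = rat (+ 63 / 16) * L + rat (+ 33 / 32) * T ⊔ rat (+ 441 / 100) * L

  price≤rate : ∀ e {L L∞ T w x} → 0# ≤ w → 0# ≤ x → w ≤ T → L + w * x ≤ L∞ →
    (e ≡ false → rat (+ 8 / 1) * w ≤ rat (+ 3 / 1) * L) →
    0# ≤ L → price e L w x ≤ w * rate T L∞
  price≤rate true {L} {L∞} {T} {w} {x} w≥0 x≥0 w≤T L≤L∞ _ _ = ≤-trans
    (≤-by (w≥0 ⊠ (rat≥0 {63} {15} ⊠ ≤⇒0≤- L≤L∞ ⊞ rat≥0 {33} {31} ⊠ ≤⇒0≤- w≤T))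
      (solve 5 (λ L M T w x → w :* (63 :/ 16 :* M :+ 33 :/ 32 :* T) :=
          63 :/ 16 :* (L :+ w :* x) :* w :+ 33 :/ 32 :* (w :* w)
          :+ w :* (63 :/ 16 :* (M :- (L :+ w :* x)) :+ 33 :/ 32 :* (T :- w))) refl L L∞ T w
          x))
    (*-monoˡ-≤ w w≥0 (≤-⊔ˡ _ _))
  price≤rate false {L} {L∞} {T} {w} {x} w≥0 x≥0 _ L≤L∞ off L≥0 = ≤-trans
    -- From `8 w ≤ 3 L`, the term 33/32 `w` is at most 99/256 `L`, and 4 + 99/256 falls short of
    -- 441/100 by 149/6400.
    (≤-by (w≥0 ⊠ (rat≥0 {441} {99} ⊠ ≤⇒0≤- L≤L∞ ⊞ rat≥0 {41} {99} ⊠ (w≥0 ⊠ x≥0)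
            ⊞ rat≥0 {33} {255} ⊠ ≤⇒0≤- (off ≡.refl) ⊞ rat≥0 {149} {6399} ⊠ L≥0))
      (solve 4 (λ L M w x → w :* (441 :/ 100 :* M) :=
          4 :/ 1 :* (L :+ w :* x) :* w :+ 33 :/ 32 :* (w :* w)
          :+ w :* (441 :/ 100 :* (M :- (L :+ w :* x)) :+ 41 :/ 100 :* (w :* x)
          :+ 33 :/ 256 :* (3 :/ 1 :* L :- 8 :/ 1 :* w) :+ 149 :/ 6400 :* L)) refl L L∞ w
          x))
    (*-monoˡ-≤ w w≥0 (≤-⊔ʳ _ _))

  -- For fixed `T` each alternative is a concave quadratic in `L` once 63/64 `L * L` is subtracted.
  -- The first is maximal at `L = 2 T`, where it equals 159/32 `T * T`, so this case fixes the
  -- ratio.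
  rate-bound : ∀ T L → T * rate T L ≤ rat (+ 159 / 32) * (T * T) + rat (+ 63 / 64) * (L * L)
  rate-bound T L = ⊔-elim (λ r → T * r ≤ rat (+ 159 / 32) * (T * T) + rat (+ 63 / 64) * (L * L))
    (≤-by (rat≥0 {63} {63} ⊠ square≥0 (rat (+ 2 / 1) * T - L))
      (solve 2 (λ T L → 159 :/ 32 :* (T :* T) :+ 63 :/ 64 :* (L :* L) :=
          T :* (63 :/ 16 :* L :+ 33 :/ 32 :* T)
          :+ 63 :/ 64 :* ((2 :/ 1 :* T :- L) :* (2 :/ 1 :* T :- L))) refl T L))
    -- Here the maximum is at `L = 56/25 T`, with 591/20000 `T * T` to spare.
    (≤-by (rat≥0 {63} {63} ⊠ square≥0 (L - rat (+ 56 / 25) * T)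
        ⊞ rat≥0 {591} {19999} ⊠ square≥0 T)
      (solve 2 (λ T L → 159 :/ 32 :* (T :* T) :+ 63 :/ 64 :* (L :* L) :=
          T :* (441 :/ 100 :* L) :+ (63 :/ 64 :* ((L :- 56 :/ 25 :* T) :* (L :- 56 :/ 25 :* T))
          :+ 591 :/ 20000 :* (T :* T))) refl T L))

-- The greedy fractional assignment.

module Greedy (ℝ : Reals) where
  open Reals ℝ hiding (_/_) renaming (zero to *-zero)
  open Unnormalised using (_/_)
  open LoadBalancing ℝ
  open Field ℝ
  open Expectations ℝ
  open Algorithm ℝ
  open Estimates ℝ

  δ-suc : ∀ {m} (a i : Fin m) → δ (suc a) (suc i) ≡ δ a i
  δ-suc a i with a ≟ i
  ... | yes _ = ≡.refl
  ... | no  _ = ≡.refl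

  rat-0-* : ∀ x → rat 0ℚᵘ * x ≈ 0#
  rat-0-* x = trans (*-congʳ rat-0) (zeroˡ x)

  rat-1-* : ∀ x → rat 1ℚᵘ * x ≈ x
  rat-1-* x = trans (*-congʳ rat-1) (*-identityˡ x)

  sum-δ : ∀ {m} (a : Fin m) (f : Fin m → Carrier) → sum (λ i → δ a i * f i) ≈ f a
  sum-δ {suc m} zero    f = trans
    (+-cong (rat-1-* (f zero))
      (trans (sum-cong-≋ {m} (λ i → rat-0-* (f (suc i)))) (sum-replicate-zero m)))
    (+-identityʳ (f zero))
  sum-δ {suc m} (suc a) f = trans
    (+-cong (rat-0-* (f zero))
      (trans (sum-cong-≋ {m} (λ i → *-congʳ (reflexive (δ-suc a i)))) (sum-δ a (f ∘ suc))))
    (+-identityˡ (f (suc a)))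

  δ≥0 : ∀ {m} (a i : Fin m) → 0# ≤ δ a i
  δ≥0 a i = δ-elim (0# ≤_) {a} {i} (λ _ → rat≥0) (λ _ → rat≥0)

  δ≤1 : ∀ {m} (a i : Fin m) → δ a i ≤ rat 1ℚᵘ
  δ≤1 a i = δ-elim (_≤ rat 1ℚᵘ) {a} {i} (λ _ → ≤-refl) (λ _ → ≤-respˡ (sym rat-0) rat≥0)

  module _ {m} (L K : Fin m → Carrier) (j : Job m) where
    open Round L K j

    x≥0 : ∀ i → 0# ≤ x i
    x≥0 i = ≤-respʳ (reflexive (≡.sym (share-draw (proj₁ ∘ chunk) i)))
      (≤-respˡ (E-const (finite draw) 0#)
        (E-mono (finite draw) (λ k → δ≥0 (proj₁ (chunk k)) i)))

    x≤1 : ∀ i → x i ≤ rat 1ℚᵘ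
    x≤1 i = ≤-respˡ (reflexive (≡.sym (share-draw (proj₁ ∘ chunk) i)))
      (≤-respʳ (E-const (finite draw) (rat 1ℚᵘ))
        (E-mono (finite draw) (λ k → δ≤1 (proj₁ (chunk k)) i)))

    priceOf : (Fin m → Carrier) → FeasibleMachine j → Carrier
    priceOf y (i , _) = price (engaged i) (L i) (w i) (y i)

    -- Each chunk costs at most the current price on `s`. Shares only grow and prices are monotone
    -- in them, so all earlier prices are dominated by the last one.
    chunks-cost : ∀ n (s : FeasibleMachine j) → let y = share (proj₁ ∘ chunks n) in
      sum (λ i → chunkCost (engaged i) (L i) (w i) (y i)) ≤ fromℕ n * h * priceOf y s
    chunks-cost zero    s = ≤-reflexive (trans
      (sum-cong-≋ {m} (λ i → chunkCost-0 (engaged i) (L i) (w i)))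
      (trans (sum-replicate-zero m) (sym (trans (*-congʳ (zeroˡ h)) (zeroˡ _)))))
    chunks-cost (suc n) s@(i* , _) = ≤-trans
      (≤-respˡ (sym total-cost) (+-mono-≤ (*-monoˡ-≤ h rat≥0 cheap) (chunks-cost n s)))
      (≤-respˡ (trans (*-congʳ (trans (distribʳ h 1# (fromℕ n)) (+-congʳ (*-identityˡ h))))
          (distribʳ (priceOf y s) h (fromℕ n * h)))
        (*-monoˡ-≤ (fromℕ (suc n) * h) (fromℕ≥0 (suc n) ⊠ rat≥0)
          (price-mono (engaged i*) (L i*) (weightAt≥0 j i*) x≤x′)))
      where
      y : Fin m → Carrier
      y = share (proj₁ ∘ chunks n)

      a : FeasibleMachine j
      a = proj₁ (cheapest y)

      cheap : priceOf y a ≤ priceOf y s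
      cheap = proj₂ (cheapest y) s

      x≤x′ : y i* ≤ h * δ (proj₁ a) i* + y i*
      x≤x′ = ≤-by (rat≥0 {1} {63} ⊠ δ≥0 (proj₁ a) i*) (+-comm _ _)

      total-cost : sum (λ i → chunkCost (engaged i) (L i) (w i) (h * δ (proj₁ a) i + y i)) ≈
                   h * priceOf y a + sum (λ i → chunkCost (engaged i) (L i) (w i) (y i))
      total-cost = trans
        (sum-cong-≋ {m} (λ i → chunkCost-step (proj₁ a) i (engaged i) (L i) (w i) (y i)))
        (trans (∑-distrib-+ {m} _ _)
          (+-congʳ (trans (sym (*-distribˡ-sum {m} h _))
            (*-congˡ (sum-δ (proj₁ a) (λ i → price (engaged i) (L i) (w i) (y i)))))))

    greedy : (s : FeasibleMachine j) →
             sum (λ i → chunkCost (engaged i) (L i) (w i) (x i)) ≤ priceOf x s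
    greedy s = ≤-respʳ
      (trans (*-congʳ (trans (rat-spec (mkℚᵘ (+ 1) 63)) (+-identityʳ 1#))) (*-identityˡ _))
      (chunks-cost 64 s)

-- Rounding with a fixed pair of drawn machines.

module Rounding (ℝ : Reals) where
  open Reals ℝ hiding (_/_) renaming (zero to *-zero)
  open Unnormalised using (_/_)
  open LoadBalancing ℝ
  open Field ℝ
  open Expectations ℝ
  open Algorithm ℝ
  open Estimates ℝ
  open Greedy ℝ

  -- The moment lemmas below share one pattern: averaging over the coin leaves an affine combination
  -- of old moments, which these rules evaluate termwise.
  E-affine₁ : {A : Set} (X : Expectation A) {f : A → Carrier} (c₀ c₁ : Carrier)
      (g₁ : A → Carrier) →
    (∀ a → f a ≈ c₀ + c₁ * g₁ a) → E X f ≈ c₀ + c₁ * E X g₁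
  E-affine₁ X c₀ c₁ g₁ f≈ = trans (E-cong X f≈)
    (trans (E-+ X _ _) (+-cong (E-const X c₀) (E-* X c₁ g₁)))

  E-affine₂ : {A : Set} (X : Expectation A) {f : A → Carrier} (c₀ c₁ c₂ : Carrier)
      (g₁ g₂ : A → Carrier) →
    (∀ a → f a ≈ c₀ + c₁ * g₁ a + c₂ * g₂ a) → E X f ≈ c₀ + c₁ * E X g₁ + c₂ * E X g₂
  E-affine₂ X c₀ c₁ c₂ g₁ g₂ f≈ = trans (E-cong X f≈)
    (trans (E-+ X _ _) (+-cong (E-affine₁ X c₀ c₁ g₁ (λ _ → refl)) (E-* X c₂ g₂)))

  E-affine₃ : {A : Set} (X : Expectation A) {f : A → Carrier} (c₀ c₁ c₂ c₃ : Carrier)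
      (g₁ g₂ g₃ : A → Carrier) →
    (∀ a → f a ≈ c₀ + c₁ * g₁ a + c₂ * g₂ a + c₃ * g₃ a) →
    E X f ≈ c₀ + c₁ * E X g₁ + c₂ * E X g₂ + c₃ * E X g₃
  E-affine₃ X c₀ c₁ c₂ c₃ g₁ g₂ g₃ f≈ = trans (E-cong X f≈)
    (trans (E-+ X _ _) (+-cong (E-affine₂ X c₀ c₁ c₂ g₁ g₂ (λ _ → refl)) (E-* X c₃ g₃)))

  E-affine₄ : {A : Set} (X : Expectation A) {f : A → Carrier} (c₀ c₁ c₂ c₃ c₄ : Carrier)
      (g₁ g₂ g₃ g₄ : A → Carrier) →
    (∀ a → f a ≈ c₀ + c₁ * g₁ a + c₂ * g₂ a + c₃ * g₃ a + c₄ * g₄ a) →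
    E X f ≈ c₀ + c₁ * E X g₁ + c₂ * E X g₂ + c₃ * E X g₃ + c₄ * E X g₄
  E-affine₄ X c₀ c₁ c₂ c₃ c₄ g₁ g₂ g₃ g₄ f≈ = trans (E-cong X f≈)
    (trans (E-+ X _ _) (+-cong (E-affine₃ X c₀ c₁ c₂ c₃ g₁ g₂ g₃ (λ _ → refl)) (E-* X c₄ g₄)))

  𝔼-product₃ : {A B C : Set} (D₁ : Distribution A) (D₂ : Distribution B) (D₃ : Distribution C)
    (f : A × B × C → Carrier) →
    𝔼 (product D₁ (product D₂ D₃)) f ≈ 𝔼 D₁ λ a → 𝔼 D₂ λ b → 𝔼 D₃ λ c → f (a , b , c)
  𝔼-product₃ D₁ D₂ D₃ f = trans (𝔼-product D₁ (product D₂ D₃) f)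
    (E-cong (finite D₁) λ a → 𝔼-product D₂ D₃ λ (b , c) → f (a , b , c))

  opaque
    draws : Expectation (Fin 64)
    draws = finite draw

    coin : Expectation (Fin 4)
    coin = finite flip

    draws-𝔼 : ∀ f → E draws f ≡ 𝔼 draw f
    draws-𝔼 f = ≡.refl

    coin-𝔼 : ∀ f → E coin f ≡ 𝔼 flip f
    coin-𝔼 f = ≡.refl

    coins-draws : ∀ f → E (finite coins) f ≈ E draws λ p → E draws λ q → E coin λ c →
        f (p , q , c)
    coins-draws f = 𝔼-product₃ draw draw flip f

    E-draws : {A : Set} (X : Expectation A) (f : A → Fin 64 → Carrier) →
              E X (λ a → E draws (f a)) ≈ E draws (λ k → E X (λ a → f a k))
    E-draws X f = E-𝔼 X draw f

  coin-average : (f : Fin 4 → Carrier) → E coin f ≈ rat (+ 1 / 4) * (f 0F + f 1F + f 2F + f 3F)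
  coin-average f = trans (reflexive (≡.trans (coin-𝔼 f) (𝔼-flip f)))
    -- The `0#` ending the sum becomes `rat 0ℚᵘ`, which the solver treats as a constant.
    (trans (+-congˡ (+-congˡ (+-congˡ (+-congˡ (sym rat-0)))))
      (solve 4 (λ a b c d → 1 :/ 4 :* a :+ (1 :/ 4 :* b :+ (1 :/ 4 :* c :+ (1 :/ 4 :* d :+ 𝟘)))
          := 1 :/ 4 :* (a :+ b :+ c :+ d)) refl (f 0F) (f 1F) (f 2F) (f 3F)))

  module _ {A : Set} (f : A → Carrier) (a b : A) where
    -- A fair choice plus a bias against the recorded direction. The bias is 1/4 because the record
    -- is consulted with probability 1/2.
    respond-follow : ∀ e t → E coin (λ c → f (if proj₂ (respond e t c) then a else b)) ≈
      rat (+ 1 / 2) * (f a + f b) + ε e * (rat (+ 1 / 4) * ((f b - f a) * value t))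
    respond-follow false t = trans (coin-average _)
      (solve 3 (λ x y v → 1 :/ 4 :* (x :+ y :+ x :+ y) :=
          1 :/ 2 :* (x :+ y) :+ 𝟘 :* (1 :/ 4 :* ((y :- x) :* v))) refl (f a) (f b) (value t))
    respond-follow true  ⊕ = trans (coin-average _)
      (solve 2 (λ x y → 1 :/ 4 :* (x :+ y :+ y :+ y) :=
          1 :/ 2 :* (x :+ y) :+ 𝟙 :* (1 :/ 4 :* ((y :- x) :* 𝟙))) refl (f a) (f b))
    respond-follow true  ⊖ = trans (coin-average _)
      (solve 2 (λ x y → 1 :/ 4 :* (x :+ y :+ x :+ x) :=
          1 :/ 2 :* (x :+ y) :+ 𝟙 :* (1 :/ 4 :* ((y :- x) :* (:- 𝟙)))) refl (f a) (f b))
    respond-follow true  ⊙ = trans (coin-average _)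
      (solve 2 (λ x y → 1 :/ 4 :* (x :+ y :+ x :+ y) :=
          1 :/ 2 :* (x :+ y) :+ 𝟙 :* (1 :/ 4 :* ((y :- x) :* 𝟘))) refl (f a) (f b))

    -- When engaged, only the two fresh outcomes leave a nonzero token, with signs opposite for `a`
    -- and `b`; hence the difference `f a - f b`.
    respond-both : ∀ e t →
      E coin (λ c → f (if proj₂ (respond e t c) then a else b) * value (proj₁ (respond e t c)))
          ≈
      (rat 1ℚᵘ - ε e) * (rat (+ 1 / 2) * (f a + f b) * value t)
          + ε e * (rat (+ 1 / 4) * (f a - f b))
    respond-both false t = trans (coin-average _)
      (solve 3 (λ x y v → 1 :/ 4 :* (x :* v :+ y :* v :+ x :* v :+ y :* v) :=
          (𝟙 :- 𝟘) :* (1 :/ 2 :* (x :+ y) :* v) :+ 𝟘 :* (1 :/ 4 :* (x :- y))) refl (f a) (f b)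
          (value t))
    respond-both true  ⊕ = trans (coin-average _)
      (solve 2 (λ x y → 1 :/ 4 :* (x :* 𝟙 :+ y :* (:- 𝟙) :+ y :* 𝟘 :+ y :* 𝟘) :=
          (𝟙 :- 𝟙) :* (1 :/ 2 :* (x :+ y) :* 𝟙) :+ 𝟙 :* (1 :/ 4 :* (x :- y))) refl (f a) (f b))
    respond-both true  ⊖ = trans (coin-average _)
      (solve 2 (λ x y → 1 :/ 4 :* (x :* 𝟙 :+ y :* (:- 𝟙) :+ x :* 𝟘 :+ x :* 𝟘) :=
          (𝟙 :- 𝟙) :* (1 :/ 2 :* (x :+ y) :* (:- 𝟙)) :+ 𝟙 :* (1 :/ 4 :* (x :- y))) refl (f a)
          (f b))
    respond-both true  ⊙ = trans (coin-average _)
      (solve 2 (λ x y → 1 :/ 4 :* (x :* 𝟙 :+ y :* (:- 𝟙) :+ x :* 𝟘 :+ y :* 𝟘) :=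
          (𝟙 :- 𝟙) :* (1 :/ 2 :* (x :+ y) :* 𝟘) :+ 𝟙 :* (1 :/ 4 :* (x :- y))) refl (f a) (f b))

  respond-token : ∀ e t → E coin (λ c → value (proj₁ (respond e t c))) ≈
      (rat 1ℚᵘ - ε e) * value t
  respond-token false t = trans (coin-average _)
    (solve 1 (λ v → 1 :/ 4 :* (v :+ v :+ v :+ v) := (𝟙 :- 𝟘) :* v) refl (value t))
  respond-token true  ⊕ = trans (coin-average _)
    (trans (solve 1 (λ z → 1 :/ 4 :* (𝟙 :+ :- 𝟙 :+ 𝟘 :+ 𝟘) := (𝟙 :- 𝟙) :* 𝟙) refl 0#) refl)
  respond-token true  ⊖ = trans (coin-average _)
    (solve 1 (λ z → 1 :/ 4 :* (𝟙 :+ :- 𝟙 :+ 𝟘 :+ 𝟘) := (𝟙 :- 𝟙) :* (:- 𝟙)) refl 0#)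
  respond-token true  ⊙ = trans (coin-average _)
    (solve 1 (λ z → 1 :/ 4 :* (𝟙 :+ :- 𝟙 :+ 𝟘 :+ 𝟘) := (𝟙 :- 𝟙) :* 𝟘) refl 0#)

  Configuration : ℕ → Set
  Configuration m = (Fin m → Carrier) × (Fin m → Token)

  R S : ∀ {m} → Fin m → Configuration m → Carrier
  R i (r , _) = r i
  S i (_ , s) = value (s i)

  -- The mixed moments are bounded on one side only: a smaller moment with a foreign token and a
  -- larger one with the own token both lower the second moment of the load.
  record Invariant {m} (X : Expectation (Configuration m)) (L K : Fin m → Carrier) : Set where
    field
      load≈       : ∀ i → E X (R i) ≈ L i
      token≈0     : ∀ i → E X (S i) ≈ rat 0ℚᵘ
      token-token : ∀ {i k} → i ≢ k → E X (λ ω → S i ω * S k ω) ≈ rat 0ℚᵘ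
      load-token  : ∀ {i k} → i ≢ k → E X (λ ω → R i ω * S k ω) ≤ rat 0ℚᵘ
      K≤          : ∀ i → K i ≤ E X (λ ω → R i ω * S i ω)
      K≥0         : ∀ i → 0# ≤ K i
      16K≤L       : ∀ i → rat (+ 16 / 1) * K i ≤ L i

  module Step {m} (L K : Fin m → Carrier) (j : Job m) where
    open Round L K j

    move : FeasibleMachine j → FeasibleMachine j → Configuration m → Fin 4 → Configuration m
    move a b (r , s) c =
      let (s′ , f) = decide s a b c in (λ i → r i + w i * δ (proj₁ f) i) , s′

    module Pair (X : Expectation (Configuration m)) (inv : Invariant X L K)
        (a b : FeasibleMachine j) where
      open Invariant inv

      -- The state after the job conditional on the draws `a` and `b`; only the past and the coin
      -- are still random.
      pair : Expectation (Configuration m)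
      pair = X >>= λ ω → coin >>= λ c → dirac (move a b ω c)

      a′ b′ : Fin m
      a′ = proj₁ a
      b′ = proj₁ b

      e : Bool
      e = engaged a′

      D : Fin m → Fin m → Carrier
      D i k = E X (λ ω → R i ω * S k ω)

      private
        α β : Fin m → Carrier
        α i = δ a′ i
        β i = δ b′ i

        follow : ∀ i ω → E coin (λ c → δ (proj₁ (proj₂ (decide (proj₂ ω) a b c))) i) ≈
          rat (+ 1 / 2) * (α i + β i) + ε e * (rat (+ 1 / 4) * ((β i - α i) * S a′ ω))
        follow i (r , s) = respond-follow (λ f → δ (proj₁ f) i) a b e (s a′)

        R-follow : ∀ i ω → E coin (λ c → R i (move a b ω c)) ≈
          R i ω + w i * (rat (+ 1 / 2) * (α i + β i)
              + ε e * (rat (+ 1 / 4) * ((β i - α i) * S a′ ω)))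
        R-follow i ω = trans (E-affine₁ coin (R i ω) (w i) _ (λ c → refl))
            (+-congˡ (*-congˡ (follow i ω)))

        S-other : ∀ {k} → a′ ≢ k → ∀ ω c → S k (move a b ω c) ≡ S k ω
        S-other {k} a≢k (r , s) c = ≡.cong value (updateAt-minimal k a′ s (a≢k ∘ ≡.sym))

        S-self : ∀ ω c → S a′ (move a b ω c) ≡ value (proj₁ (respond e (proj₂ ω a′) c))
        S-self (r , s) c = ≡.cong value (updateAt-updates a′ s)

        average-other : ∀ {k} → a′ ≢ k → ∀ ω (g : Fin 4 → Carrier) →
          E coin (λ c → g c * S k (move a b ω c)) ≈ S k ω * E coin g
        average-other a≢k ω g = trans
          (E-cong coin λ c → trans (*-congˡ (reflexive (S-other a≢k ω c))) (*-comm _ _))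
          (E-* coin _ g)

        average-self : ∀ ω → E coin (λ c → S a′ (move a b ω c)) ≈ (rat 1ℚᵘ - ε e) * S a′ ω
        average-self ω = trans (E-cong coin λ c → reflexive (S-self ω c))
            (respond-token e (proj₂ ω a′))

        scaled-0 : ∀ c {f g} → (∀ ω → E coin (λ k → f (move a b ω k)) ≈ c * g ω) → E X g ≈
            rat 0ℚᵘ → E pair f ≈ rat 0ℚᵘ
        scaled-0 c {f} {g} f≈ g≈0 = trans (E-cong X f≈) (trans (E-* X c g) (trans (*-congˡ g≈0)
          (solve 1 (λ c → c :* 𝟘 := 𝟘) refl c)))

      pair-load : ∀ i → E pair (R i) ≈ L i + rat (+ 1 / 2) * w i * (α i + β i)
      pair-load i = trans
        (E-affine₂ X (rat (+ 1 / 2) * w i * (α i + β i)) (rat 1ℚᵘ)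
            (rat (+ 1 / 4) * w i * ε e * (β i - α i)) (R i) (S a′)
          (λ ω → trans (R-follow i ω)
            (solve 6 (λ r w x y e v → r :+
                w :* (1 :/ 2 :* (x :+ y) :+ e :* (1 :/ 4 :* ((y :- x) :* v))) :=
                1 :/ 2 :* w :* (x :+ y) :+ 𝟙 :* r :+ 1 :/ 4 :* w :* e :* (y :- x) :* v) refl
                (R i ω) (w i) (α i) (β i) (ε e) (S a′ ω))))
        (trans (+-cong (+-congˡ (*-congˡ (load≈ i))) (*-congˡ (token≈0 a′)))
          (solve 5 (λ L w x y c → 1 :/ 2 :* w :* (x :+ y) :+ 𝟙 :* L :+ c :* 𝟘 :=
              L :+ 1 :/ 2 :* w :* (x :+ y)) refl (L i) (w i) (α i) (β i)
              (rat (+ 1 / 4) * w i * ε e * (β i - α i))))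

      pair-square : ∀ i → E pair (λ ω → R i ω * R i ω) ≈
        E X (λ ω → R i ω * R i ω) + (w i * L i + rat (+ 1 / 2) * (w i * w i)) * (α i + β i)
          + rat (+ 1 / 2) * w i * ε e * (β i - α i) * D i a′
      pair-square i = trans
        (E-affine₄ X (rat (+ 1 / 2) * (w i * w i) * (α i + β i)) (rat 1ℚᵘ) (w i * (α i + β i))
          (rat (+ 1 / 2) * w i * ε e * (β i - α i))
              (rat (+ 1 / 4) * (w i * w i) * ε e * (β i - α i))
          (λ ω → R i ω * R i ω) (R i) (λ ω → R i ω * S a′ ω) (S a′)
          (λ ω → trans
            (E-affine₁ coin (R i ω * R i ω) (rat (+ 2 / 1) * R i ω * w i + w i * w i) _
              -- For an indicator `d` the square is affine in `d`, so `follow` applies.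
              (λ c → δ-elim (λ d → (R i ω + w i * d) * (R i ω + w i * d)
                                 ≈ R i ω * R i ω + (rat (+ 2 / 1) * R i ω * w i
                                     + w i * w i) * d) {proj₁ (proj₂ (decide (proj₂ ω) a b c))}
                                     {i}
                (λ _ → solve 2 (λ r w → (r :+ w :* 𝟙) :* (r :+ w :* 𝟙) :=
                    r :* r :+ (2 :/ 1 :* r :* w :+ w :* w) :* 𝟙) refl (R i ω) (w i))
                (λ _ → solve 2 (λ r w → (r :+ w :* 𝟘) :* (r :+ w :* 𝟘) :=
                    r :* r :+ (2 :/ 1 :* r :* w :+ w :* w) :* 𝟘) refl (R i ω) (w i))))
            (trans (+-congˡ (*-congˡ (follow i ω)))
              (solve 6 (λ r w x y e v → r :* r
                  :+ (2 :/ 1 :* r :* w :+ w :* w) :* (1 :/ 2 :* (x :+ y)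
                  :+ e :* (1 :/ 4 :* ((y :- x) :* v))) :=
                  1 :/ 2 :* (w :* w) :* (x :+ y) :+ 𝟙 :* (r :* r) :+ w :* (x :+ y) :* r
                  :+ 1 :/ 2 :* w :* e :* (y :- x) :* (r :* v)
                  :+ 1 :/ 4 :* (w :* w) :* e :* (y :- x) :* v) refl (R i ω)
                  (w i) (α i) (β i) (ε e) (S a′ ω)))))
        (trans (+-cong (+-congʳ (+-congˡ (*-congˡ (load≈ i)))) (*-congˡ (token≈0 a′)))
          (solve 7 (λ Q L w x y d c → 1 :/ 2 :* (w :* w) :* (x :+ y) :+ 𝟙 :* Q
              :+ w :* (x :+ y) :* L :+ d :+ c :* 𝟘 :=
              Q :+ (w :* L :+ 1 :/ 2 :* (w :* w)) :* (x :+ y) :+ d) refl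
              (E X (λ ω → R i ω * R i ω)) (L i) (w i) (α i) (β i)
              (rat (+ 1 / 2) * w i * ε e * (β i - α i) * D i a′)
                  (rat (+ 1 / 4) * (w i * w i) * ε e * (β i - α i))))

      pair-token : ∀ k → E pair (S k) ≈ rat 0ℚᵘ
      pair-token k with a′ ≟ k
      ... | yes ≡.refl = scaled-0 (rat 1ℚᵘ - ε e) {S a′} average-self (token≈0 a′)
      ... | no  a≢k    = scaled-0 (rat 1ℚᵘ) {S k}
        (λ ω → trans (E-cong coin (λ c → reflexive (S-other a≢k ω c)))
          (trans (E-const coin _) (sym (rat-1-* _)))) (token≈0 k)

      -- At most one of the two tokens changes, and its conditional mean is a constant multiple of
      -- its old value; the vanishing moment is merely rescaled.
      pair-token-token : ∀ {i k} → i ≢ k → E pair (λ ω → S i ω * S k ω) ≈ rat 0ℚᵘ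
      pair-token-token {i} {k} i≢k with a′ ≟ k
      ... | no a≢k with a′ ≟ i
      ...   | yes ≡.refl = scaled-0 (rat 1ℚᵘ - ε e) {λ ω → S a′ ω * S k ω}
        (λ ω → trans (average-other a≢k ω _) (trans (*-congˡ (average-self ω))
          (solve 3 (λ u v c → v :* (c :* u) := c :* (u :* v)) refl (S a′ ω) (S k ω)
              (rat 1ℚᵘ - ε e)))) (token-token i≢k)
      ...   | no a≢i     = scaled-0 (rat 1ℚᵘ) {λ ω → S i ω * S k ω}
        (λ ω → trans (average-other a≢k ω _)
          (trans (*-congˡ (trans (E-cong coin (λ c → reflexive (S-other a≢i ω c)))
              (E-const coin _)))
            (solve 2 (λ u v → v :* u := 𝟙 :* (u :* v)) refl (S i ω) (S k ω)))) (token-token i≢k)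
      pair-token-token {i} {k} i≢k | yes ≡.refl =
          scaled-0 (rat 1ℚᵘ - ε e) {λ ω → S i ω * S a′ ω}
        (λ ω → trans (E-cong coin (λ c → *-comm _ _))
            (trans (average-other (i≢k ∘ ≡.sym) ω _) (trans (*-congˡ (average-self ω))
          (solve 3 (λ u v c → v :* (c :* u) := c :* (v :* u)) refl (S a′ ω) (S i ω)
              (rat 1ℚᵘ - ε e))))) (token-token i≢k)

      pair-load-token : ∀ i k → E pair (λ ω → R i ω * S k ω) ≈
        D i k + α k * ε (engaged k) * (rat (+ 1 / 4) * w i * (α i - β i) - D i k)
      pair-load-token i k with a′ ≟ k
      ... | yes ≡.refl = trans
        (E-affine₂ X (ε e * (rat (+ 1 / 4) * w i * (α i - β i))) (rat 1ℚᵘ - ε e)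
          ((rat 1ℚᵘ - ε e) * (rat (+ 1 / 2) * w i * (α i + β i))) (λ ω → R i ω * S a′ ω) (S a′)
          (λ ω → trans (E-affine₂ coin (rat 0ℚᵘ) (R i ω) (w i) _ _
              (λ c → trans (*-congˡ (reflexive (S-self ω c)))
              (solve 4 (λ r w d v → (r :+ w :* d) :* v := 𝟘 :+ r :* v :+ w :* (d :* v)) refl
                  (R i ω) (w i) (δ (proj₁ (proj₂ (decide (proj₂ ω) a b c))) i)
                  (value (proj₁ (respond e (proj₂ ω a′) c))))))
            (trans (+-cong (+-congˡ (*-congˡ (respond-token e (proj₂ ω a′))))
                (*-congˡ (respond-both (λ f → δ (proj₁ f) i) a b e (proj₂ ω a′))))
              (solve 6 (λ r w x y e v → 𝟘 :+ r :* ((𝟙 :- e) :* v)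
                  :+ w :* ((𝟙 :- e) :* (1 :/ 2 :* (x :+ y) :* v) :+ e :* (1 :/ 4 :* (x :- y)))
                  := e :* (1 :/ 4 :* w :* (x :- y)) :+ (𝟙 :- e) :* (r :* v)
                  :+ (𝟙 :- e) :* (1 :/ 2 :* w :* (x :+ y)) :* v) refl (R i ω) (w i)
                  (α i) (β i) (ε e) (S a′ ω)))))
        (trans (+-congˡ (*-congˡ (token≈0 a′)))
          (solve 5 (λ d e w x y → e :* (1 :/ 4 :* w :* (x :- y)) :+ (𝟙 :- e) :* d
              :+ (𝟙 :- e) :* (1 :/ 2 :* w :* (x :+ y)) :* 𝟘 :=
              d :+ 𝟙 :* e :* (1 :/ 4 :* w :* (x :- y) :- d)) refl (D i a′) (ε e) (w i) (α i)
              (β i)))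
      -- Token `k` stays put while the decision is biased through `S a′`; the bias drops out because
      -- distinct tokens are uncorrelated.
      ... | no a≢k = trans
        (E-affine₃ X (rat 0ℚᵘ) (rat 1ℚᵘ) (rat (+ 1 / 2) * w i * (α i + β i))
            (rat (+ 1 / 4) * w i * ε e * (β i - α i))
          (λ ω → R i ω * S k ω) (S k) (λ ω → S a′ ω * S k ω)
          (λ ω → trans (average-other a≢k ω _) (trans (*-congˡ (R-follow i ω))
            (solve 7 (λ r w x y e v s → s :* (r
                :+ w :* (1 :/ 2 :* (x :+ y) :+ e :* (1 :/ 4 :* ((y :- x) :* v)))) :=
                𝟘 :+ 𝟙 :* (r :* s) :+ 1 :/ 2 :* w :* (x :+ y) :* s
                :+ 1 :/ 4 :* w :* e :* (y :- x) :* (v :* s)) refl (R i ω) (w i) (α i)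
                (β i) (ε e) (S a′ ω) (S k ω)))))
        (trans (+-cong (+-congˡ (*-congˡ (token≈0 k))) (*-congˡ (token-token a≢k)))
          (solve 5 (λ d c f e g → 𝟘 :+ 𝟙 :* d :+ c :* 𝟘 :+ f :* 𝟘 := d :+ 𝟘 :* e :* g) refl
              (D i k) (rat (+ 1 / 2) * w i * (α i + β i))
              (rat (+ 1 / 4) * w i * ε e * (β i - α i)) (ε (engaged k))
              (rat (+ 1 / 4) * w i * (α i - β i) - D i k)))

-- Averaging over the two draws.

module Averaging (ℝ : Reals) where
  open Reals ℝ hiding (_/_) renaming (zero to *-zero)
  open Unnormalised using (_/_)
  open LoadBalancing ℝ
  open Field ℝ
  open Expectations ℝ
  open Algorithm ℝ
  open Estimates ℝ
  open Greedy ℝ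
  open Rounding ℝ

  ε≥0 : ∀ e → 0# ≤ ε e
  ε≥0 true  = rat≥0
  ε≥0 false = rat≥0

  δ-≢ : ∀ {m} {a i : Fin m} → a ≢ i → δ a i ≡ rat 0ℚᵘ
  δ-≢ {a = a} {i} a≢i with a ≟ i
  ... | yes a≡i = contradiction a≡i a≢i
  ... | no  _   = ≡.refl

  -- For an engaged machine the right side is `(1 - x) * (D + w x / 4)`, monotone in `D`, so the
  -- lower bound `K` may replace `D`.
  refreshed-correlation : ∀ e {L K w x D} → K ≤ D → x ≤ rat 1ℚᵘ →
    nextCorrelation e L K w x ≤ D + ε e * (rat (+ 1 / 4) * w * (rat 1ℚᵘ - x) - D) * x
  refreshed-correlation false {L} {K} {w} {x} {D} K≤D x≤1 = ≤-respʳ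
    (solve 3 (λ D w x → D := D :+ 𝟘 :* (1 :/ 4 :* w :* (𝟙 :- x) :- D) :* x) refl D w x) K≤D
  refreshed-correlation true {L} {K} {w} {x} {D} K≤D x≤1 =
      ⊓-elim (_≤ D + rat 1ℚᵘ * (rat (+ 1 / 4) * w * (rat 1ℚᵘ - x) - D) * x)
    (λ _ → first) (λ c₂≤c₁ → ≤-trans c₂≤c₁ first)
    where
    first : (rat 1ℚᵘ - x) * (K + rat (+ 1 / 4) * (w * x)) ≤
        D + rat 1ℚᵘ * (rat (+ 1 / 4) * w * (rat 1ℚᵘ - x) - D) * x
    first = ≤-by (≤⇒0≤- x≤1 ⊠ ≤⇒0≤- K≤D)
      (solve 4 (λ D K w x → D :+ 𝟙 :* (1 :/ 4 :* w :* (𝟙 :- x) :- D) :* x :=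
          (𝟙 :- x) :* (K :+ 1 :/ 4 :* (w :* x)) :+ (𝟙 :- x) :* (D :- K)) refl D K w x)

  module _ {m} (L K : Fin m → Carrier) (j : Job m) (X : Expectation (Configuration m))
      (inv : Invariant X L K) where
    open Round L K j
    open Invariant inv
    private
      module S = Step L K j
      module P (p q : Fin 64) = S.Pair X inv (chunk p) (chunk q)

      w≥0 : ∀ i → 0# ≤ w i
      w≥0 = weightAt≥0 j

      α : Fin m → Fin 64 → Carrier
      α i p = δ (proj₁ (chunk p)) i

      D : Fin m → Fin m → Carrier
      D i k = E X (λ ω → R i ω * S k ω)

      draw-α : ∀ i → E draws (α i) ≈ x i
      draw-α i = reflexive (≡.trans (draws-𝔼 (α i)) (≡.sym (share-draw (proj₁ ∘ chunk) i)))

      draw-affine : ∀ {f} i c₀ c₁ → (∀ p → f p ≈ c₀ + c₁ * α i p) → E draws f ≈ c₀ + c₁ * x i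
      draw-affine i c₀ c₁ f≈ = trans (E-affine₁ draws c₀ c₁ (α i) f≈)
          (+-congˡ (*-congˡ (draw-α i)))

    after : Expectation (Configuration m)
    after = X >>= λ ω → finite coins >>= λ (p , q , c) → dirac (S.move (chunk p) (chunk q) ω c)

    private
      -- Moving the draws outside the past lets the lemmas for a fixed pair apply pointwise.
      after-draw : ∀ f → E after f ≈ E draws λ p → E draws λ q → E (P.pair p q) f
      after-draw f = trans (E-cong X
          (λ ω → coins-draws (λ (p , q , c) → f (S.move (chunk p) (chunk q) ω c))))
        (trans (E-draws X (λ ω p → E draws λ q → E coin λ c →
            f (S.move (chunk p) (chunk q) ω c)))
          (E-cong draws (λ p → E-draws X
              (λ ω q → E coin λ c → f (S.move (chunk p) (chunk q) ω c)))))

      after-const : ∀ f {c} → (∀ p q → E (P.pair p q) f ≈ c) → E after f ≈ c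
      after-const f {c} f≈c = trans (after-draw f)
        (trans (E-cong draws (λ p → trans (E-cong draws (f≈c p)) (E-const draws c)))
            (E-const draws c))

      after-load : ∀ i → E after (R i) ≈ L i + w i * x i
      after-load i = trans (after-draw (R i)) (trans
        (draw-affine i (L i + rat (+ 1 / 2) * w i * x i) (rat (+ 1 / 2) * w i) λ p → trans
          (draw-affine i (L i + rat (+ 1 / 2) * w i * α i p) (rat (+ 1 / 2) * w i) λ q → trans
            (P.pair-load p q i)
            (solve 4 (λ L w a b → L :+ 1 :/ 2 :* w :* (a :+ b) :=
                L :+ 1 :/ 2 :* w :* a :+ 1 :/ 2 :* w :* b) refl (L i) (w i) (α i p) (α i q)))
          (solve 4 (λ L w a x → L :+ 1 :/ 2 :* w :* a :+ 1 :/ 2 :* w :* x :=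
              L :+ 1 :/ 2 :* w :* x :+ 1 :/ 2 :* w :* a) refl (L i) (w i) (α i p) (x i)))
        (solve 3 (λ L w x → L :+ 1 :/ 2 :* w :* x :+ 1 :/ 2 :* w :* x := L :+ w :* x) refl (L i)
            (w i) (x i)))

      -- If the first draw is `k`, it does not load `i`; an engaged `k` then replaces the old moment
      -- by `- w i / 4` when the second draw is `i` and by 0 otherwise.
      pair-load-token≤0 : ∀ {i k} → i ≢ k → ∀ p q → E (P.pair p q) (λ ω → R i ω * S k ω) ≤
          rat 0ℚᵘ
      pair-load-token≤0 {i} {k} i≢k p q = ≤-respˡ (sym (P.pair-load-token p q i k))
        (δ-elim (λ d → D i k + d * ε (engaged k) * (rat (+ 1 / 4) * w i * (α i p - α i q) - D i
            k) ≤ rat 0ℚᵘ)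
          {proj₁ (chunk p)} {k}
          (λ a≡k → ≤-respˡ (+-congˡ (*-congˡ (+-congʳ (*-congˡ (+-congʳ
              (reflexive (≡.sym (δ-≢ (λ a≡i → i≢k (≡.trans (≡.sym a≡i) a≡k))))))))))
                  (refresh (engaged k)))
          (λ _ → ≤-respˡ (solve 3 (λ d e g → d := d :+ 𝟘 :* e :* g) refl (D i k) (ε (engaged k))
              (rat (+ 1 / 4) * w i * (α i p - α i q) - D i k)) (load-token i≢k)))
        where
        refresh : ∀ e → D i k + rat 1ℚᵘ * ε
            e * (rat (+ 1 / 4) * w i * (rat 0ℚᵘ - α i q) - D i k) ≤ rat 0ℚᵘ
        refresh true  = ≤-by (rat≥0 {1} {3} ⊠ w≥0 i ⊠ δ≥0 (proj₁ (chunk q)) i)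
          (solve 3 (λ d w b → 𝟘 := d :+ 𝟙 :* 𝟙 :* (1 :/ 4 :* w :* (𝟘 :- b) :- d)
              :+ 1 :/ 4 :* w :* b) refl (D i k) (w i) (α i q))
        refresh false = ≤-respˡ (solve 2 (λ d g → d := d :+ 𝟙 :* 𝟘 :* g) refl (D i k)
            (rat (+ 1 / 4) * w i * (rat 0ℚᵘ - α i q) - D i k)) (load-token i≢k)

      after-load-token : ∀ {i k} → i ≢ k → E after (λ ω → R i ω * S k ω) ≤ rat 0ℚᵘ
      after-load-token {i} {k} i≢k =
          ≤-respˡ (sym (after-draw (λ ω → R i ω * S k ω))) (≤-respʳ (E-const draws _)
        (E-mono draws λ p → ≤-respʳ (E-const draws _) (E-mono draws (pair-load-token≤0 i≢k p))))

      after-correlation : ∀ i → E after (λ ω → R i ω * S i ω) ≈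
        D i i + ε (engaged i) * (rat (+ 1 / 4) * w i * (rat 1ℚᵘ - x i) - D i i) * x i
      after-correlation i = trans (after-draw (λ ω → R i ω * S i ω)) (draw-affine i (D i i)
        (ε (engaged i) * (rat (+ 1 / 4) * w i * (rat 1ℚᵘ - x i) - D i i)) λ p → trans
          (draw-affine i (D i i + α i p * ε (engaged i) * (rat (+ 1 / 4) * w i * α i p - D i i))
            (- (α i p * ε (engaged i) * (rat (+ 1 / 4) * w i))) λ q → trans
            (P.pair-load-token p q i i)
            (solve 5 (λ d a b e w → d :+ a :* e :* (1 :/ 4 :* w :* (a :- b) :- d) :=
                d :+ a :* e :* (1 :/ 4 :* w :* a :- d) :+ (:- (a :* e :* (1 :/ 4 :* w))) :* b)
                refl (D i i) (α i p) (α i q) (ε (engaged i)) (w i)))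
          -- Averaging the second draw leaves a square of the first indicator, which the case split
          -- makes linear.
          (δ-elim (λ a → D i i + a * ε (engaged i) * (rat (+ 1 / 4) * w i * a - D i i)
              + (- (a * ε (engaged i) * (rat (+ 1 / 4) * w i))) * x i
              ≈ D i i + ε (engaged i) * (rat (+ 1 / 4) * w i * (rat 1ℚᵘ - x i) - D i i) * a)
                  {proj₁ (chunk p)} {i}
            (λ _ → solve 4 (λ d x e w → d :+ 𝟙 :* e :* (1 :/ 4 :* w :* 𝟙 :- d)
                :+ (:- (𝟙 :* e :* (1 :/ 4 :* w))) :* x :=
                d :+ e :* (1 :/ 4 :* w :* (𝟙 :- x) :- d) :* 𝟙) refl (D i i) (x i)
                (ε (engaged i)) (w i))
            (λ _ → solve 4 (λ d x e w → d :+ 𝟘 :* e :* (1 :/ 4 :* w :* 𝟘 :- d)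
                :+ (:- (𝟘 :* e :* (1 :/ 4 :* w))) :* x :=
                d :+ e :* (1 :/ 4 :* w :* (𝟙 :- x) :- d) :* 𝟘) refl (D i i) (x i)
                (ε (engaged i)) (w i))))

    after-invariant : Invariant after L′ K′
    after-invariant = record
      { load≈       = after-load
      ; token≈0     = λ k → after-const (S k) (λ p q → P.pair-token p q k)
      ; token-token = λ {i} {k} i≢k →
          after-const (λ ω → S i ω * S k ω) (λ p q → P.pair-token-token p q i≢k)
      ; load-token  = after-load-token
      ; K≤          = λ i → ≤-respʳ (sym (after-correlation i))
          (refreshed-correlation (engaged i) (K≤ i) (x≤1 L K j i))
      ; K≥0         = λ i → nextCorrelation≥0 (K≥0 i) (16K≤L i) (w≥0 i) (x≥0 L K j i)
          (x≤1 L K j i) (engaged i)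
      ; 16K≤L       = λ i → nextCorrelation-bound (K≥0 i) (16K≤L i) (w≥0 i) (x≥0 L K j i)
          (x≤1 L K j i) (engaged i)
      }

    private
      -- If the first draw is `i`, the token moment is at least `K i` and yields the gain; otherwise
      -- it is at most 0, which cannot increase the second moment.
      correlation-term : ∀ i p → let a = proj₁ (chunk p) in
        rat (+ 1 / 2) * w i * ε (engaged a) * (x i - α i p) * D i a
          ≤ - (rat (+ 1 / 2) * w i * ε (engaged i) * ((rat 1ℚᵘ - x i) * K i)) * α i p
      correlation-term i p = δ-elim
        (λ d → let a = proj₁ (chunk p) in
          rat (+ 1 / 2) * w i * ε (engaged a) * (x i - d) * D i a
            ≤ - (rat (+ 1 / 2) * w i * ε (engaged i) * ((rat 1ℚᵘ - x i) * K i)) * d)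
        {proj₁ (chunk p)} {i} same other
        where
        same : ∀ {a} → a ≡ i →
          rat (+ 1 / 2) * w i * ε (engaged a) * (x i - rat 1ℚᵘ) * D i a
            ≤ - (rat (+ 1 / 2) * w i * ε (engaged i) * ((rat 1ℚᵘ - x i) * K i)) * rat 1ℚᵘ
        same ≡.refl = ≤-by
          (rat≥0 {1} {1} ⊠ w≥0 i ⊠ ε≥0 (engaged i) ⊠ (≤⇒0≤- (x≤1 L K j i) ⊠ ≤⇒0≤- (K≤ i)))
          (solve 5 (λ w e x K d → :- (1 :/ 2 :* w :* e :* ((𝟙 :- x) :* K)) :* 𝟙 :=
              1 :/ 2 :* w :* e :* (x :- 𝟙) :* d :+ 1 :/ 2 :* w :* e :* ((𝟙 :- x) :* (d :- K)))
              refl (w i) (ε (engaged i)) (x i) (K i) (D i i))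

        other : ∀ {a} → a ≢ i →
          rat (+ 1 / 2) * w i * ε (engaged a) * (x i - rat 0ℚᵘ) * D i a
            ≤ - (rat (+ 1 / 2) * w i * ε (engaged i) * ((rat 1ℚᵘ - x i) * K i)) * rat 0ℚᵘ
        other {a} a≢i = ≤-by
          (rat≥0 {1} {1} ⊠ w≥0 i ⊠ ε≥0 (engaged a)
              ⊠ (x≥0 L K j i ⊠ ≤⇒0≤- (load-token (a≢i ∘ ≡.sym))))
          (solve 5 (λ w e x d c → c :* 𝟘 :=
              1 :/ 2 :* w :* e :* (x :- 𝟘) :* d :+ 1 :/ 2 :* w :* e :* (x :* (𝟘 :- d))) refl
              (w i) (ε (engaged a)) (x i) (D i a)
              (- (rat (+ 1 / 2) * w i * ε (engaged i) * ((rat 1ℚᵘ - x i) * K i))))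

    after-square : ∀ i → E after (λ ω → R i ω * R i ω) + gain (engaged i) (K i) (w i) (x i)
      ≤ E X (λ ω → R i ω * R i ω) + (rat (+ 2 / 1) * L i + w i) * (w i * x i)
    after-square i = ≤-trans (+-monoˡ-≤ _
        (≤-respˡ (sym (after-draw (λ ω → R i ω * R i ω))) (E-mono draws λ p → ≤-respˡ
        (sym (draw-affine i
          (Q + B * α i p - rat (+ 1 / 2) * w i * ε (engaged (proj₁ (chunk p))) * α i p * D i
              (proj₁ (chunk p)))
          (B + rat (+ 1 / 2) * w i * ε (engaged (proj₁ (chunk p))) * D i (proj₁ (chunk p)))
              λ q → trans
          (P.pair-square p q i)
          (solve 7 (λ Q B a b w e d → Q :+ B :* (a :+ b) :+ 1 :/ 2 :* w :* e :* (b :- a) :* d :=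
              Q :+ B :* a :- 1 :/ 2 :* w :* e :* a :* d :+ (B :+ 1 :/ 2 :* w :* e :* d) :* b)
              refl Q B (α i p) (α i q) (w i) (ε (engaged (proj₁ (chunk p))))
              (D i (proj₁ (chunk p))))))
        (≤-respˡ
          (solve 7 (λ Q B a x w e d → Q :+ B :* (a :+ x) :+ 1 :/ 2 :* w :* e :* (x :- a) :* d :=
              Q :+ B :* a :- 1 :/ 2 :* w :* e :* a :* d :+ (B :+ 1 :/ 2 :* w :* e :* d) :* x)
              refl Q B (α i p) (x i) (w i) (ε (engaged (proj₁ (chunk p))))
              (D i (proj₁ (chunk p))))
          (+-mono-≤ (≤-refl {Q + B * (α i p + x i)}) (correlation-term i p))))))
      (≤-reflexive (trans (+-congʳ (draw-affine i (Q + B * x i) (B - g) λ p →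
          solve 5 (λ Q B a x g → Q :+ B :* (a :+ x) :+ (:- g) :* a :=
              Q :+ B :* x :+ (B :- g) :* a) refl Q B (α i p) (x i) g))
        (solve 6 (λ Q L w x e K → Q :+ (w :* L :+ 1 :/ 2 :* (w :* w)) :* x
            :+ ((w :* L :+ 1 :/ 2 :* (w :* w)) :- 1 :/ 2 :* w :* e :* ((𝟙 :- x) :* K)) :* x
            :+ e :* (1 :/ 2 :* (w :* x) :* ((𝟙 :- x) :* K)) :=
            Q :+ (2 :/ 1 :* L :+ w) :* (w :* x)) refl Q (L i) (w i) (x i)
            (ε (engaged i)) (K i))))
      where
      Q B g : Carrier
      Q = E X (λ ω → R i ω * R i ω)
      B = w i * L i + rat (+ 1 / 2) * (w i * w i)
      g = rat (+ 1 / 2) * w i * ε (engaged i) * ((rat 1ℚᵘ - x i) * K i)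

-- Induction over the jobs and the competitive ratio.

module Competitiveness (ℝ : Reals) where
  open Reals ℝ hiding (_/_) renaming (zero to *-zero)
  open Unnormalised using (_/_)
  open LoadBalancing ℝ
  open Field ℝ
  open Expectations ℝ
  open Algorithm ℝ
  open Estimates ℝ
  open Greedy ℝ
  open Rounding ℝ
  open Averaging ℝ

  expectationFrom-cong : ∀ {m} (A : RandomizedOnlineAlgorithm m) μ (jobs : Instance m)
      {f g : Assignment jobs → Carrier} →
    (∀ x → f x ≈ g x) → expectationFrom A μ jobs f ≈ expectationFrom A μ jobs g
  expectationFrom-cong A μ []         f≈g = f≈g []
  expectationFrom-cong A μ (j ∷ jobs) f≈g =
      E-cong (finite (RandomizedOnlineAlgorithm.step A μ j))
    λ (μ′ , s) → expectationFrom-cong A μ′ jobs λ x → f≈g (s ∷ x)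

  contribution≥0 : ∀ {m} (j : Job m) s i → 0# ≤ contribution j s i
  contribution≥0 j s i = ≤-respʳ (sym (contribution-δ j s i)) (weightAt≥0 j i ⊠ δ≥0 (proj₁ s) i)

  contribution-self : ∀ {m} (j : Job m) s → contribution j s (proj₁ s) ≈ weightAt j (proj₁ s)
  contribution-self j s@(i , _) =
      trans (contribution-δ j s i) (δ-elim (λ d → weightAt j i * d ≈ weightAt j i) {i} {i}
    (λ _ → trans (*-comm _ _) (rat-1-* _)) (λ i≢i → contradiction ≡.refl i≢i))

  load≥0 : ∀ {m} {jobs : Instance m} (x : Assignment jobs) i → 0# ≤ load x i
  load≥0 {jobs = []}    []      i = ≤-refl
  load≥0 {jobs = j ∷ _} (s ∷ x) i = contribution≥0 j s i ⊞ load≥0 x i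

  does-true : {P : Set} (P? : Dec P) → does P? ≡ true → P
  does-true (yes p) _ = p

  does-false : {P : Set} (P? : Dec P) → does P? ≡ false → ¬ P
  does-false (no ¬p) _ = ¬p

  -- The realised loads `r` of past jobs are carried by the analysis, so the induction can proceed
  -- along the job list.
  costFrom : ∀ {m} {jobs : Instance m} → (Fin m → Carrier) → Assignment jobs → Carrier
  costFrom r x = sum λ i → (r i + load x i) * (r i + load x i)

  expectedCost : ∀ {m} → Expectation (Configuration m) → (L K : Fin m → Carrier) → Instance m →
      Carrier
  expectedCost {m} X L K jobs =
    E X λ (r , s) → expectationFrom (algorithm m) (memory L K s) jobs (costFrom r)

  potential : ∀ {m} → Expectation (Configuration m) → (L K : Fin m → Carrier) → Fin m → Carrier
  potential X L K i = E X (λ ω → R i ω * R i ω) + L i * L i - rat (+ 1 / 4) * (L i * K i)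

  expectedCost-∷ : ∀ {m} (X : Expectation (Configuration m)) L K (j : Job m) jobs
      (inv : Invariant X L K) →
    expectedCost X L K (j ∷ jobs) ≈
        expectedCost (after L K j X inv) (Round.L′ L K j) (Round.K′ L K j) jobs
  expectedCost-∷ {m} X L K j jobs inv = E-cong X λ (r , s) →
      E-cong (finite coins) λ (p , q , c) →
    let (s′ , f) = decide s (chunk p) (chunk q) c
    in expectationFrom-cong (algorithm m) (memory L′ K′ s′) jobs λ x → sum-cong-≋ {m} λ i →
      let eq : r i + (contribution j f i + load x i) ≈ r i + w i * δ (proj₁ f) i + load x i
          eq = trans (+-congˡ (+-congʳ (contribution-δ j f i))) (sym (+-assoc _ _ _))
      in *-cong eq eq
    where open Round L K j

  module _ {m} (L K : Fin m → Carrier) (j : Job m) (X : Expectation (Configuration m))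
      (inv : Invariant X L K) where
    open Round L K j
    open Invariant inv

    potential-after : sum (potential (after L K j X inv) L′ K′) ≤
      sum (potential X L K) + sum (λ i → chunkCost (engaged i) (L i) (w i) (x i))
    potential-after = ≤-respʳ (∑-distrib-+ {m} _ _) (sum-mono {m} λ i →
      potential-step (K≥0 i) (16K≤L i) (weightAt≥0 j i) (x≥0 L K j i) (x≤1 L K j i) (engaged i)
        (does-true (rat (+ 3 / 1) * L i ≤? rat (+ 8 / 1) * w i)) (after-square L K j X inv i))

    L≥0 : ∀ i → 0# ≤ L i
    L≥0 i = ≤-trans (rat≥0 ⊠ K≥0 i) (16K≤L i)

    L≤L′ : ∀ i → L i ≤ L′ i
    L≤L′ i = ≤-by (weightAt≥0 j i ⊠ x≥0 L K j i) refl

    -- The rate uses final loads, so one function of `T` and `L∞` bounds the price of every job and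
    -- the job-wise bounds add up.
    price≤ : ∀ (s : FeasibleMachine j) (T L∞ : Fin m → Carrier) →
        (∀ i → contribution j s i ≤ T i) → (∀ i → L′ i ≤ L∞ i) →
      priceOf L K j x s ≤ sum (λ i → contribution j s i * rate (T i) (L∞ i))
    price≤ s@(k , _) T L∞ ≤T ≤L∞ = ≤-respʳ
      (trans (sym (sum-δ k (λ i → w i * rate (T i) (L∞ i)))) (sum-cong-≋ {m} λ i → trans
        (sym (*-assoc _ _ _)) (*-congʳ (trans (*-comm _ _) (sym (contribution-δ j s i))))))
      (price≤rate (engaged k) (weightAt≥0 j k) (x≥0 L K j k)
        (≤-respˡ (contribution-self j s) (≤T k)) (≤L∞ k)
        (≰⇒≥ ∘ does-false (rat (+ 3 / 1) * L k ≤? rat (+ 8 / 1) * w k)) (L≥0 k))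

  -- `L∞` is the final fractional load, independent of the comparison assignment. `T` stays fixed
  -- while `y` shrinks to the remaining jobs, so every job is charged at the same rate.
  competitive : ∀ {m} (jobs : Instance m) X (L K : Fin m → Carrier) → Invariant X L K →
    ∃ λ (L∞ : Fin m → Carrier) → (∀ i → L i ≤ L∞ i) ×
      (∀ (T : Fin m → Carrier) (y : Assignment jobs) → (∀ i → load y i ≤ T i) →
        expectedCost X L K jobs + sum (λ i → rat (+ 63 / 64) * (L∞ i * L∞ i))
          ≤ sum (potential X L K) + sum (λ i → load y i * rate (T i) (L∞ i)))
  competitive {m} [] X L K inv = L , (λ _ → ≤-refl) , λ { T [] _ → bound T }
    where
    open Invariant inv
    bound : ∀ T → expectedCost X L K [] + sum (λ i → rat (+ 63 / 64) * (L i * L i))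
              ≤ sum (potential X L K) + sum (λ i → 0# * rate (T i) (L i))
    bound T = ≤-respˡ (sym (+-congʳ expected))
        (≤-respˡ (∑-distrib-+ {m} _ _) (≤-respʳ (∑-distrib-+ {m} _ _) (sum-mono {m} λ i →
      ≤-respʳ (sym (trans (+-congˡ (zeroˡ _)) (+-identityʳ _)))
        -- By `16 K ≤ L`, the correlation term consumes at most 1/64 of `L * L`.
        (≤-by (rat≥0 {1} {63} ⊠ (L≥0′ i ⊠ ≤⇒0≤- (16K≤L i)))
          (solve 3 (λ Q L K → Q :+ L :* L :- 1 :/ 4 :* (L :* K) :=
              Q :+ 63 :/ 64 :* (L :* L) :+ 1 :/ 64 :* (L :* (L :- 16 :/ 1 :* K))) refl
              (E X (λ ω → R i ω * R i ω)) (L i) (K i))))))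
      where
      L≥0′ : ∀ i → 0# ≤ L i
      L≥0′ i = ≤-trans (rat≥0 ⊠ K≥0 i) (16K≤L i)
      expected : expectedCost X L K [] ≈ sum (λ i → E X (λ ω → R i ω * R i ω))
      expected = trans (E-cong X λ ω → sum-cong-≋ {m} λ i →
          *-cong (+-identityʳ (R i ω)) (+-identityʳ (R i ω)))
        (E-sum X (λ i ω → R i ω * R i ω))
  competitive {m} (j ∷ jobs) X L K inv =
    let (L∞ , L′≤L∞ , later) = competitive jobs (after L K j X inv) (Round.L′ L K j)
            (Round.K′ L K j) (after-invariant L K j X inv)
    in L∞ , (λ i → ≤-trans (L≤L′ L K j X inv i) (L′≤L∞ i)) , λ { T (s ∷ y) ≤T →
      let c≤T i = ≤-trans (≤-by (load≥0 y i) refl) (≤T i)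
          y≤T i = ≤-trans (≤-by (contribution≥0 j s i) (+-comm _ _)) (≤T i)
          job   = ≤-trans (greedy L K j s) (price≤ L K j X inv s T L∞ c≤T L′≤L∞)
      in ≤-respˡ (+-congʳ (sym (expectedCost-∷ X L K j jobs inv)))
         (≤-trans (later T y y≤T)
         (≤-respʳ (trans (+-assoc _ _ _) (+-congˡ (trans (sym (∑-distrib-+ {m} _ _))
                    (sum-cong-≋ {m} λ i → sym (distribʳ (rate (T i) (L∞ i)) (contribution j s i)
                        (load y i))))))
           (+-mono-≤ (≤-trans (potential-after L K j X inv) (+-mono-≤ ≤-refl job)) ≤-refl))) }

  origin : ∀ {m} → Expectation (Configuration m)
  origin = dirac ((λ _ → 0#) , λ _ → ⊙)

  origin-invariant : ∀ {m} → Invariant {m} origin (λ _ → 0#) (λ _ → 0#)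
  origin-invariant = record
    { load≈       = λ _ → refl
    ; token≈0     = λ _ → refl
    ; token-token = λ _ → solve 1 (λ z → 𝟘 :* 𝟘 := 𝟘) refl 0#
    ; load-token  = λ _ → ≤-reflexive (solve 1 (λ z → z :* 𝟘 := 𝟘) refl 0#)
    ; K≤          = λ _ → ≤-reflexive (sym (zeroˡ _))
    ; K≥0         = λ _ → ≤-refl
    ; 16K≤L       = λ _ → ≤-reflexive (zeroʳ _)
    }

  expectation≤ : ∀ {m} (jobs : Instance m) (y : Assignment jobs) →
    expectation (algorithm m) jobs cost ≤ rat (+ 159 / 32) * cost y
  expectation≤ {m} jobs y =
    let (L∞ , _ , bound) = competitive jobs origin (λ _ → 0#) (λ _ → 0#) origin-invariant
    -- Taking `T` to be the full load of `y` turns the charges into `T * rate T L∞`; the 63/64 `L∞`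
    -- squares from `rate-bound` then cancel.
    in ≤-respˡ (sym expectation≈) (cancel (≤-trans (bound (load y) y (λ _ → ≤-refl))
      (≤-respˡ (trans (sym (+-identityˡ _)) (+-congʳ (sym potential≈0)))
        (≤-respʳ (trans (∑-distrib-+ {m} _ _) (+-congʳ (sym (*-distribˡ-sum {m} _ _))))
          (sum-mono {m} λ i → rate-bound (load y i) (L∞ i))))))
    where
    expectation≈ : expectation (algorithm m) jobs cost ≈
        expectedCost origin (λ _ → 0#) (λ _ → 0#) jobs
    expectation≈ = trans (E-const (finite (uniform 0)) _)
      (expectationFrom-cong (algorithm m) _ jobs λ x → sum-cong-≋ {m} λ i →
        sym (*-cong (+-identityˡ (load x i)) (+-identityˡ (load x i))))

    potential≈0 : sum (potential {m} origin (λ _ → 0#) (λ _ → 0#)) ≈ 0#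
    potential≈0 = trans (sum-cong-≋ {m} λ i → trans
      (solve 1 (λ z → z :* z :+ z :* z :- 1 :/ 4 :* (z :* z) := z :* (7 :/ 4 :* z)) refl 0#)
          (zeroˡ _)) (sum-replicate-zero m)

    cancel : ∀ {u v z} → u + z ≤ v + z → u ≤ v
    cancel {u} {v} {z} u+z≤v+z = ≤-by (≤⇒0≤- u+z≤v+z)
        (solve 3 (λ u v z → v := u :+ (v :+ z :- (u :+ z))) refl u v z)

  -- 4.9843 exceeds 159/32 by 311/20000.
  constant : ∀ c → 0# ≤ c → rat (+ 159 / 32) * c ≤ (fromℕ 49843 * fromℕ 10000 ⁻¹) * c
  constant c c≥0 = ≤-respʳ (*-congʳ (reflexive (rat-fraction 49843 9999)))
    (≤-by (rat≥0 {311} {19999} ⊠ c≥0)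
        (solve 1 (λ c → 49843 :/ 10000 :* c := 159 :/ 32 :* c :+ 311 :/ 20000 :* c) refl c))

  cost≥0 : ∀ {m} {jobs : Instance m} (x : Assignment jobs) → 0# ≤ cost x
  cost≥0 {m} x = ≤-respˡ (sum-replicate-zero m) (sum-mono {m} λ i → square≥0 (load x i))

theorem1p1 : (ℝ : Reals) →
    let open Reals ℝ
        open LoadBalancing ℝ
    in Σ ((m : ℕ) → RandomizedOnlineAlgorithm m) λ A →
         (m : ℕ) (jobs : Instance m) →
         ∃ λ OPT →
           IsMinimum (cost {m} {jobs}) OPT ×
           expectation (A m) jobs cost ≤ (fromℕ 49843 / fromℕ 10000) * OPT
theorem1p1 ℝ = algorithm , λ m jobs →
  let (y , least) = minimum-Assignment jobs cost
  in cost y , ((y , refl) , least) , ≤-trans (expectation≤ jobs y)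
      (constant (cost y) (cost≥0 y))
  where
  open Reals ℝ using (refl)
  open LoadBalancing ℝ using (cost)
  open Field ℝ using (≤-trans)
  open Algorithm ℝ using (algorithm; minimum-Assignment)
  open Competitiveness ℝ using (expectation≤; constant; cost≥0)
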